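{- For $m,n\geq 0$, \[ H_{m,n}(q,t) = \sum_{a=0}^{\min\{m,n\}} \binom{m}{a}\binom{n}{a}q^a(qt+1)^{m+n-2a}. \]
   Context: Fix $m,n\geq 0$ and disjoint alphabets $X=\{x_1,\dots,x_m\}$, $Y=\{y_1,\dots,y_n\}$. A shuffle word is a word over $X\cup Y$ without repeated letters in which $x_i$ precedes $x_j$ and $y_i$ precedes $y_j$ whenever both letters occur and $i<j$; $\mathsf{Shuf}(m,n)$ is the set of shuffle words. The bubble lattice $\mathbf{Bub}(m,n)$ is $\mathsf{Shuf}(m,n)$ ordered by the reflexive–transitive closure of the elementary moves $\mathbf u\to\mathbf v$: (indel) $\mathbf v$ is obtained from $\mathbf u$ by deleting a letter of $X$ or inserting a letter of $Y$; (transposition) $\mathbf v$ is obtained from $\mathbf u$ by replacing a consecutive factor $xy$ ($x\in X,y\in Y$) by $yx$. For $\mathbf u\in\mathsf{Shuf}(m,n)$, $\mathsf{in}(\mathbf u)$ is the number of elements covered by $\mathbf u$ in $\mathbf{Bub}(m,n)$ and $\mathsf{in}_{\mathrm{indel}}(\mathbf u)$ is the number of those lower covers $\mathbf u'$ that differ from $\mathbf u$ by an indel (i.e. have a different set of letters). The $H$-triangle is $H_{m,n}(q,t)=\sum_{\mathbf u\in\mathsf{Shuf}(m,n)} q^{\mathsf{in}(\mathbf u)}t^{\mathsf{in}_{\mathrm{indel}}(\mathbf u)}$. -}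

module Defs where

open import Data.Nat using (ℕ; zero; suc; _+_; _*_; _∸_; _<_; _⊔_; _⊓_)
open import Data.Nat.Combinatorics using (_C_)
open import Data.Fin using (Fin)
open import Data.List using (List; []; _∷_; _++_; length; map; upTo)
open import Data.Nat.ListAction using (sum)
open import Data.List.Membership.Propositional using (_∈_; _∉_)
open import Data.List.Relation.Unary.Unique.Propositional using (Unique)
open import Data.Product using (Σ; ∃; _×_; _,_)
open import Data.Sum using (_⊎_)
open import Relation.Nullary using (¬_)
open import Relation.Binary.PropositionalEquality using (_≡_; _≢_)
open import Relation.Binary.Construct.Closure.ReflexiveTransitive using (Star)
open import Function.Bundles using (_⇔_)

-- Letters and words over X = {x_0..x_{m-1}} ⊔ Y = {y_0..y_{n-1}}
-- (indices shifted to start at 0; only the order of indices matters)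

data Letter (m n : ℕ) : Set where
  x : Fin m → Letter m n
  y : Fin n → Letter m n

Word : ℕ → ℕ → Set
Word m n = List (Letter m n)

Precedes : ∀ {m n} → Letter m n → Letter m n → Word m n → Set
Precedes a b w = ∃ λ p → ∃ λ q → ∃ λ r → w ≡ p ++ (a ∷ q ++ (b ∷ r))

IsShuffle : ∀ {m n} → Word m n → Set
IsShuffle {m} {n} w =
  Unique w
  × (∀ (i j : Fin m) → Data.Fin._<_ i j → x i ∈ w → x j ∈ w → Precedes (x i) (x j) w)
  × (∀ (i j : Fin n) → Data.Fin._<_ i j → y i ∈ w → y j ∈ w → Precedes (y i) (y j) w)

data Move {m n : ℕ} : Word m n → Word m n → Set where
  delX  : ∀ p s (i : Fin m) → Move (p ++ (x i ∷ s)) (p ++ s)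
  insY  : ∀ p s (j : Fin n) → Move (p ++ s) (p ++ (y j ∷ s))
  trans : ∀ p s (i : Fin m) (j : Fin n) →
          Move (p ++ (x i ∷ y j ∷ s)) (p ++ (y j ∷ x i ∷ s))

ShufMove : ∀ {m n} → Word m n → Word m n → Set
ShufMove u v = IsShuffle u × IsShuffle v × Move u v

_≤Bub_ : ∀ {m n} → Word m n → Word m n → Set
u ≤Bub v = Star ShufMove u v

_⋖_ : ∀ {m n} → Word m n → Word m n → Set
u' ⋖ u = IsShuffle u' × u' ≤Bub u × u' ≢ u
         × (∀ w → IsShuffle w → u' ≤Bub w → w ≤Bub u → (w ≡ u') ⊎ (w ≡ u))

SameLetters : ∀ {m n} → Word m n → Word m n → Set
SameLetters u v = ∀ a → (a ∈ u) ⇔ (a ∈ v)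

HasCard : ∀ {m n} → (Word m n → Set) → ℕ → Set
HasCard {m} {n} P k =
  ∃ λ (L : List (Word m n)) → Unique L × (∀ w → (w ∈ L) ⇔ P w) × length L ≡ k

InDeg : ∀ {m n} → Word m n → ℕ → Set
InDeg u k = HasCard (λ u' → u' ⋖ u) k

InDegIndel : ∀ {m n} → Word m n → ℕ → Set
InDegIndel u k = HasCard (λ u' → (u' ⋖ u) × ¬ SameLetters u' u) k

-- coefficient of q^i t^j in H_{m,n}(q,t)
-- is the number of shuffle words u with in(u) = i and in_indel(u) = j
HCoeff : ℕ → ℕ → ℕ → ℕ → ℕ → Set
HCoeff m n i j c = HasCard {m} {n} (λ u → IsShuffle u × InDeg u i × InDegIndel u j) c

-- Bivariate polynomials in q, t with ℕ coefficients, as coefficient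
-- functions (i , j) ↦ coefficient of q^i t^j.

Poly : Set
Poly = ℕ → ℕ → ℕ

Σ≤ : ℕ → (ℕ → ℕ) → ℕ
Σ≤ k f = sum (map f (upTo (suc k)))

_+P_ : Poly → Poly → Poly
(f +P g) i j = f i j + g i j

_*P_ : Poly → Poly → Poly
(f *P g) i j = Σ≤ i λ a → Σ≤ j λ b → f a b * g (i ∸ a) (j ∸ b)

constP : ℕ → Poly
constP c zero zero = c
constP c _    _    = 0

oneP : Poly
oneP = constP 1

qP : Poly
qP (suc zero) zero = 1
qP _ _ = 0

tP : Poly
tP zero (suc zero) = 1
tP _ _ = 0

_^P_ : Poly → ℕ → Poly
f ^P zero  = oneP
f ^P suc k = f *P (f ^P k)

ΣP : ℕ → (ℕ → Poly) → Poly
ΣP zero    F = F 0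
ΣP (suc k) F = ΣP k F +P F (suc k)

RHS : ℕ → ℕ → Poly
RHS m n = ΣP (m ⊓ n) λ a →
  constP ((m C a) * (n C a)) *P ((qP ^P a) *P (((qP *P tP) +P oneP) ^P (m + n ∸ 2 * a)))

{-# OPTIONS --safe #-}

-- A lower cover of u inserts a missing x i directly before the next larger x-letter
-- (or at the end), deletes a y j that is not followed by an x-letter, or turns a
-- factor yx into xy: each missing x i and each present y j contributes exactly one.
-- Hence a word with a factors yx has weight q^a (qt)^e, where e counts the missing
-- x-letters and the present y-letters outside these factors. The factors are given by
-- a letters of X and a letters of Y, and the other m + n - 2a letters are present or
-- absent independently of each other.

module Submission where

open import Defs
open import Data.Nat using (ℕ; zero; suc; _+_; _*_; _∸_; _⊓_; _≤_; _<_; s≤s)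
open import Data.Nat.Properties as ℕ
  using ( +-identityʳ; +-assoc; +-comm; +-suc; +-cancelʳ-≡; +-mono-≤; +-∸-assoc
        ; *-identityˡ; *-zeroʳ; *-distribˡ-+; *-distribʳ-+
        ; _≤?_; ≤-total; ≤-trans; ≤-reflexive; ≰⇒>; m≤n+m; m∸n+n≡m; m≤n⇒m⊓n≡m; m≥n⇒m⊓n≡n )
open import Data.Nat.Combinatorics using (_C_; nCk+nC[k+1]≡[n+1]C[k+1]; k>n⇒nCk≡0)
open import Data.Nat.ListAction using (sum)
open import Data.Nat.Solver using (module +-*-Solver)
open import Data.Fin as Fin using (Fin)
import Data.Fin.Properties as Fin
open import Data.List using (List; []; _∷_; _++_; length; map; filter; allFin; upTo)
open import Data.List.Properties
  using (length-map; length-++; length-tabulate; map-upTo; map-applyUpTo; ∷-injectiveˡ; ∷-injectiveʳ)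
open import Data.List.Membership.Propositional using (_∈_; _∉_)
open import Data.List.Membership.Propositional.Properties
  using (∈-map⁺; ∈-map⁻; ∈-++⁺ˡ; ∈-++⁺ʳ; ∈-++⁻; ∈-filter⁺; ∈-filter⁻; ∈-allFin)
open import Data.List.Membership.Propositional.Properties.WithK using (unique∧set⇒bag)
import Data.List.Membership.DecPropositional as DecMembership
open import Data.List.Relation.Unary.Any using (here; there)
open import Data.List.Relation.Unary.All as All using (All; []; _∷_)
open import Data.List.Relation.Unary.AllPairs as AllPairs using (AllPairs; []; _∷_)
import Data.List.Relation.Unary.AllPairs.Properties as AllPairs
open import Data.List.Relation.Unary.Unique.Propositional using (Unique)
open import Data.List.Relation.Unary.Unique.Propositional.Properties
  using (Unique[x∷xs]⇒x∉xs; map⁺; ++⁺; filter⁺; allFin⁺)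
open import Data.List.Relation.Binary.BagAndSetEquality using (∼bag⇒↭)
open import Data.List.Relation.Binary.Permutation.Propositional.Properties using (↭-length)
open import Data.Product using (∃; ∃₂; _×_; _,_; proj₁; proj₂)
open import Data.Sum using (_⊎_; inj₁; inj₂; [_,_]′)
open import Data.Empty using (⊥-elim)
open import Relation.Nullary using (¬_; Dec; yes; no; ¬?; contradiction)
open import Relation.Binary.Definitions using (DecidableEquality; tri<; tri≈; tri>)
open import Relation.Binary.Construct.Closure.ReflexiveTransitive using (ε; _◅_)
open import Relation.Binary.PropositionalEquality
  using (_≡_; _≢_; refl; sym; cong; cong₂; subst; module ≡-Reasoning) renaming (trans to ≡-trans)
open import Function using (_∘_; id)
open import Function.Bundles using (_⇔_; mk⇔; Equivalence)

-- Recurrences for the right-hand side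

-- The independence rests on a normal form. Between two consecutive factors yx no y-letter is
-- directly followed by an x-letter, so the x-letters there precede the y-letters; the k-th chosen
-- x-letter is paired with the k-th chosen y-letter, and every present letter has a forced position.
-- Instead of a bijection with pairs of subsets, the words are generated from left to right by a
-- grammar with two states, according to whether a chosen x-letter still waits for its y. Pascal's
-- rule gives the right-hand side the same pair of recurrences, once a second family of sums is
-- introduced for the waiting state. On the side of the order, the obstacle is that `⋖` speaks of
-- arbitrary chains of moves; these are controlled by comparing letters and inversions, which can be
-- read off the two end words alone.

infix 4 _≐_
_≐_ : Poly → Poly → Set
f ≐ g = ∀ i j → f i j ≡ g i j

Σ≤-suc : ∀ k f → Σ≤ (suc k) f ≡ f 0 + Σ≤ k (f ∘ suc)
Σ≤-suc k f = cong (λ l → f 0 + sum l)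
  (≡-trans (map-applyUpTo suc f (suc k)) (sym (map-upTo (f ∘ suc) (suc k))))

Σ≤-cong : ∀ k {f g} → (∀ a → f a ≡ g a) → Σ≤ k f ≡ Σ≤ k g
Σ≤-cong zero    e = cong (_+ 0) (e 0)
Σ≤-cong (suc k) {f} {g} e = begin
  Σ≤ (suc k) f           ≡⟨ Σ≤-suc k f ⟩
  f 0 + Σ≤ k (f ∘ suc)   ≡⟨ cong₂ _+_ (e 0) (Σ≤-cong k (e ∘ suc)) ⟩
  g 0 + Σ≤ k (g ∘ suc)   ≡⟨ Σ≤-suc k g ⟨
  Σ≤ (suc k) g           ∎
  where open ≡-Reasoning

Σ≤-+ : ∀ k f g → Σ≤ k (λ a → f a + g a) ≡ Σ≤ k f + Σ≤ k g
Σ≤-+ zero    f g = solve 2 (λ a b → a :+ b :+ con 0 := a :+ con 0 :+ (b :+ con 0)) refl (f 0) (g 0)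
  where open +-*-Solver
Σ≤-+ (suc k) f g = begin
  Σ≤ (suc k) (λ a → f a + g a)                          ≡⟨ Σ≤-suc k (λ a → f a + g a) ⟩
  f 0 + g 0 + Σ≤ k (λ a → f (suc a) + g (suc a))        ≡⟨ cong (f 0 + g 0 +_) (Σ≤-+ k (f ∘ suc) (g ∘ suc)) ⟩
  f 0 + g 0 + (Σ≤ k (f ∘ suc) + Σ≤ k (g ∘ suc))         ≡⟨ solve 4 (λ a b c d → a :+ b :+ (c :+ d) := a :+ c :+ (b :+ d)) refl (f 0) (g 0) _ _ ⟩
  f 0 + Σ≤ k (f ∘ suc) + (g 0 + Σ≤ k (g ∘ suc))         ≡⟨ cong₂ _+_ (Σ≤-suc k f) (Σ≤-suc k g) ⟨
  Σ≤ (suc k) f + Σ≤ (suc k) g                           ∎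
  where open ≡-Reasoning; open +-*-Solver

Σ≤-0 : ∀ k → Σ≤ k (λ _ → 0) ≡ 0
Σ≤-0 zero    = refl
Σ≤-0 (suc k) = ≡-trans (Σ≤-suc k (λ _ → 0)) (Σ≤-0 k)

Σ≤-head : ∀ k f → (∀ a → f (suc a) ≡ 0) → Σ≤ k f ≡ f 0
Σ≤-head zero    f e = +-identityʳ (f 0)
Σ≤-head (suc k) f e = begin
  Σ≤ (suc k) f          ≡⟨ Σ≤-suc k f ⟩
  f 0 + Σ≤ k (f ∘ suc)  ≡⟨ cong (f 0 +_) (≡-trans (Σ≤-cong k e) (Σ≤-0 k)) ⟩
  f 0 + 0               ≡⟨ +-identityʳ (f 0) ⟩
  f 0                   ∎
  where open ≡-Reasoning

-- Products with q, t, qt and 1 + qt as shifts of the coefficient table. The recurrences multiply by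
-- nothing else, so general associativity and commutativity of `*P` can be avoided.
mulQ mulT mulQT mulS : Poly → Poly
mulQ f zero    j = 0
mulQ f (suc i) j = f i j
mulT f i zero    = 0
mulT f i (suc j) = f i j
mulQT = mulQ ∘ mulT
mulS f = f +P mulQT f

scale : ℕ → Poly → Poly
scale c f i j = c * f i j

mulQ-cong : ∀ {f g} → f ≐ g → mulQ f ≐ mulQ g
mulQ-cong e zero    j = refl
mulQ-cong e (suc i) j = e i j

mulT-cong : ∀ {f g} → f ≐ g → mulT f ≐ mulT g
mulT-cong e i zero    = refl
mulT-cong e i (suc j) = e i j

mulS-cong : ∀ {f g} → f ≐ g → mulS f ≐ mulS g
mulS-cong e i j = cong₂ _+_ (e i j) (mulQ-cong (mulT-cong e) i j)

*P-congˡ : ∀ {f f'} → f ≐ f' → ∀ g → (f *P g) ≐ (f' *P g)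
*P-congˡ e g i j = Σ≤-cong i λ a → Σ≤-cong j λ b → cong (_* g (i ∸ a) (j ∸ b)) (e a b)

*P-distribʳ-+P : ∀ f f' g → ((f +P f') *P g) ≐ ((f *P g) +P (f' *P g))
*P-distribʳ-+P f f' g i j = ≡-trans
  (Σ≤-cong i λ a → ≡-trans
    (Σ≤-cong j λ b → *-distribʳ-+ (g (i ∸ a) (j ∸ b)) (f a b) (f' a b))
    (Σ≤-+ j (λ b → f a b * g (i ∸ a) (j ∸ b)) (λ b → f' a b * g (i ∸ a) (j ∸ b))))
  (Σ≤-+ i (λ a → Σ≤ j λ b → f a b * g (i ∸ a) (j ∸ b)) (λ a → Σ≤ j λ b → f' a b * g (i ∸ a) (j ∸ b)))

constP-*P : ∀ c g → (constP c *P g) ≐ scale c g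
constP-*P c g i j = ≡-trans
  (Σ≤-head i _ λ a → Σ≤-0 j)
  (Σ≤-head j _ λ b → refl)

oneP-*P : ∀ g → (oneP *P g) ≐ g
oneP-*P g i j = ≡-trans (constP-*P 1 g i j) (*-identityˡ (g i j))

mulQ-*P : ∀ f g → (mulQ f *P g) ≐ mulQ (f *P g)
mulQ-*P f g zero    j = ≡-trans (+-identityʳ _) (Σ≤-0 j)
mulQ-*P f g (suc i) j = ≡-trans
  (Σ≤-suc i (λ a → Σ≤ j λ b → mulQ f a b * g (suc i ∸ a) (j ∸ b)))
  (cong (_+ (f *P g) i j) (Σ≤-0 j))

mulT-*P : ∀ f g → (mulT f *P g) ≐ mulT (f *P g)
mulT-*P f g i zero    = Σ≤-0 i
mulT-*P f g i (suc j) = Σ≤-cong i λ a →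
  Σ≤-suc j (λ b → mulT f a b * g (i ∸ a) (suc j ∸ b))

qP≐ : qP ≐ mulQ oneP
qP≐ zero          j       = refl
qP≐ (suc zero)    zero    = refl
qP≐ (suc zero)    (suc j) = refl
qP≐ (suc (suc i)) j       = refl

tP≐ : tP ≐ mulT oneP
tP≐ zero    zero          = refl
tP≐ zero    (suc zero)    = refl
tP≐ zero    (suc (suc j)) = refl
tP≐ (suc i) zero          = refl
tP≐ (suc i) (suc j)       = refl

qP-*P : ∀ g → (qP *P g) ≐ mulQ g
qP-*P g i j = begin
  (qP *P g) i j          ≡⟨ *P-congˡ qP≐ g i j ⟩
  (mulQ oneP *P g) i j   ≡⟨ mulQ-*P oneP g i j ⟩
  mulQ (oneP *P g) i j   ≡⟨ mulQ-cong (oneP-*P g) i j ⟩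
  mulQ g i j             ∎
  where open ≡-Reasoning

tP-*P : ∀ g → (tP *P g) ≐ mulT g
tP-*P g i j = begin
  (tP *P g) i j          ≡⟨ *P-congˡ tP≐ g i j ⟩
  (mulT oneP *P g) i j   ≡⟨ mulT-*P oneP g i j ⟩
  mulT (oneP *P g) i j   ≡⟨ mulT-cong (oneP-*P g) i j ⟩
  mulT g i j             ∎
  where open ≡-Reasoning

sP : Poly
sP = (qP *P tP) +P oneP

sP-*P : ∀ g → (sP *P g) ≐ mulS g
sP-*P g i j = begin
  (sP *P g) i j                               ≡⟨ *P-distribʳ-+P (qP *P tP) oneP g i j ⟩
  ((qP *P tP) *P g) i j + (oneP *P g) i j     ≡⟨ cong₂ _+_ qt (oneP-*P g i j) ⟩
  mulQT g i j + g i j                         ≡⟨ +-comm (mulQT g i j) (g i j) ⟩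
  mulS g i j                                  ∎
  where
  open ≡-Reasoning
  qt : ((qP *P tP) *P g) i j ≡ mulQT g i j
  qt = begin
    ((qP *P tP) *P g) i j    ≡⟨ *P-congˡ (qP-*P tP) g i j ⟩
    (mulQ tP *P g) i j       ≡⟨ mulQ-*P tP g i j ⟩
    mulQ (tP *P g) i j       ≡⟨ mulQ-cong (tP-*P g) i j ⟩
    mulQT g i j              ∎

-- Products of powers of q and 1 + qt

mono : ℕ → ℕ → Poly
mono a k = (qP ^P a) *P (sP ^P k)

mulQ-mulS : ∀ g → mulQ (mulS g) ≐ mulS (mulQ g)
mulQ-mulS g zero          zero    = refl
mulQ-mulS g zero          (suc j) = refl
mulQ-mulS g (suc zero)    zero    = refl
mulQ-mulS g (suc zero)    (suc j) = refl
mulQ-mulS g (suc (suc i)) zero    = refl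
mulQ-mulS g (suc (suc i)) (suc j) = refl

mono-0 : ∀ k → mono 0 k ≐ (sP ^P k)
mono-0 k = oneP-*P (sP ^P k)

mono-sucˡ : ∀ a k → mono (suc a) k ≐ mulQ (mono a k)
mono-sucˡ a k i j = ≡-trans (*P-congˡ (qP-*P (qP ^P a)) (sP ^P k) i j) (mulQ-*P (qP ^P a) (sP ^P k) i j)

-- The new factor 1 + qt stands to the right of the powers of q, whereas the rules for `*P` act on
-- the left; the induction on a carries it past one q at a time.
mono-sucʳ : ∀ a k → mono a (suc k) ≐ mulS (mono a k)
mono-sucʳ zero k i j = begin
  mono 0 (suc k) i j       ≡⟨ mono-0 (suc k) i j ⟩
  (sP *P (sP ^P k)) i j    ≡⟨ sP-*P (sP ^P k) i j ⟩
  mulS (sP ^P k) i j       ≡⟨ mulS-cong (mono-0 k) i j ⟨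
  mulS (mono 0 k) i j      ∎
  where open ≡-Reasoning
mono-sucʳ (suc a) k i j = begin
  mono (suc a) (suc k) i j    ≡⟨ mono-sucˡ a (suc k) i j ⟩
  mulQ (mono a (suc k)) i j   ≡⟨ mulQ-cong (mono-sucʳ a k) i j ⟩
  mulQ (mulS (mono a k)) i j  ≡⟨ mulQ-mulS (mono a k) i j ⟩
  mulS (mulQ (mono a k)) i j  ≡⟨ mulS-cong (mono-sucˡ a k) i j ⟨
  mulS (mono (suc a) k) i j   ∎
  where open ≡-Reasoning

mulQ-scale : ∀ c f → mulQ (scale c f) ≐ scale c (mulQ f)
mulQ-scale c f zero    j = sym (*-zeroʳ c)
mulQ-scale c f (suc i) j = refl

mulQT-scale : ∀ c f → mulQT (scale c f) ≐ scale c (mulQT f)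
mulQT-scale c f zero    j       = sym (*-zeroʳ c)
mulQT-scale c f (suc i) zero    = sym (*-zeroʳ c)
mulQT-scale c f (suc i) (suc j) = refl

mulS-scale : ∀ c f → mulS (scale c f) ≐ scale c (mulS f)
mulS-scale c f i j = ≡-trans (cong (c * f i j +_) (mulQT-scale c f i j)) (sym (*-distribˡ-+ c (f i j) _))

ΣP-cong : ∀ N {F G : ℕ → Poly} → (∀ a → F a ≐ G a) → ΣP N F ≐ ΣP N G
ΣP-cong zero    e i j = e 0 i j
ΣP-cong (suc N) e i j = cong₂ _+_ (ΣP-cong N e i j) (e (suc N) i j)

ΣP-suc : ∀ N F → ΣP (suc N) F ≐ (F 0 +P ΣP N (F ∘ suc))
ΣP-suc zero    F i j = refl
ΣP-suc (suc N) F i j = ≡-trans (cong (_+ F (suc (suc N)) i j) (ΣP-suc N F i j)) (+-assoc (F 0 i j) _ _)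

ΣP-+P : ∀ N F G → ΣP N (λ a → F a +P G a) ≐ (ΣP N F +P ΣP N G)
ΣP-+P zero    F G i j = refl
ΣP-+P (suc N) F G i j = ≡-trans (cong (_+ (F (suc N) i j + G (suc N) i j)) (ΣP-+P N F G i j))
  (solve 4 (λ a b c d → a :+ b :+ (c :+ d) := a :+ c :+ (b :+ d)) refl (ΣP N F i j) (ΣP N G i j) _ _)
  where open +-*-Solver

ΣP-zero : ∀ N {F : ℕ → Poly} i j → (∀ a → F a i j ≡ 0) → ΣP N F i j ≡ 0
ΣP-zero zero    i j e = e 0
ΣP-zero (suc N) i j e = cong₂ _+_ (ΣP-zero N i j e) (e (suc N))

ΣP-mulQ : ∀ N F → ΣP N (mulQ ∘ F) ≐ mulQ (ΣP N F)
ΣP-mulQ zero    F i j = refl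
ΣP-mulQ (suc N) F zero    j = cong (_+ 0) (ΣP-mulQ N F zero j)
ΣP-mulQ (suc N) F (suc i) j = cong (_+ F (suc N) i j) (ΣP-mulQ N F (suc i) j)

ΣP-mulT : ∀ N F → ΣP N (mulT ∘ F) ≐ mulT (ΣP N F)
ΣP-mulT zero    F i j = refl
ΣP-mulT (suc N) F i zero    = cong (_+ 0) (ΣP-mulT N F i zero)
ΣP-mulT (suc N) F i (suc j) = cong (_+ F (suc N) i j) (ΣP-mulT N F i (suc j))

ΣP-mulS : ∀ N F → ΣP N (mulS ∘ F) ≐ mulS (ΣP N F)
ΣP-mulS N F i j = ≡-trans (ΣP-+P N F (mulQT ∘ F) i j) (cong (ΣP N F i j +_)
  (≡-trans (ΣP-mulQ N (mulT ∘ F) i j) (mulQ-cong (ΣP-mulT N F) i j)))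

ΣP-truncate : ∀ N d {F : ℕ → Poly} → (∀ a → N < a → ∀ i j → F a i j ≡ 0) → ΣP (d + N) F ≐ ΣP N F
ΣP-truncate N zero    e i j = refl
ΣP-truncate N (suc d) {F} e i j = ≡-trans
  (cong₂ _+_ (ΣP-truncate N d e i j) (e (suc (d + N)) (s≤s (m≤n+m N d)) i j))
  (+-identityʳ (ΣP N F i j))

-- Words from which the first x-letter of a pair yx has already been chosen are
-- counted by termB; the exponent is m + n ∸ (2a + 1), written in the shape to
-- which suc m + n ∸ 2 * suc a reduces.
termA termB : ℕ → ℕ → ℕ → Poly
termA m n a = scale ((m C a) * (n C a)) (mono a (m + n ∸ 2 * a))
termB m n a = scale ((m C a) * (n C suc a)) (mono a (m + n ∸ (a + suc (a + 0))))

-- The exponents are truncated differences, so raising one by 1 is safe only while nothing is cut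
-- off. Outside a ≤ m and b ≤ n a binomial coefficient is zero and both sides vanish.
scale-mulS : ∀ m n a b k c → (a ≤ m → b ≤ n → k ≡ suc c) →
             ∀ e → scale ((m C a) * (n C b)) (mono e k) ≐ mulS (scale ((m C a) * (n C b)) (mono e c))
scale-mulS m n a b k c h e i j with a ≤? m | b ≤? n
... | yes p | yes q rewrite h p q = ≡-trans
  (cong ((m C a) * (n C b) *_) (mono-sucʳ e c i j)) (sym (mulS-scale ((m C a) * (n C b)) (mono e c) i j))
... | no ¬p | _ rewrite k>n⇒nCk≡0 (≰⇒> ¬p) = sym (mulS-scale 0 (mono e c) i j)
... | yes _ | no ¬q rewrite k>n⇒nCk≡0 (≰⇒> ¬q) | *-zeroʳ (m C a) = sym (mulS-scale 0 (mono e c) i j)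

-- Pascal's rule for the added x-letter: outside the factors it contributes 1 + qt; inside one it
-- contributes q and leaves one more letter of Y than of X to be chosen.
termA-sucˡ : ∀ m n a → termA (suc m) n (suc a) ≐ (mulS (termA m n (suc a)) +P mulQ (termB m n a))
termA-sucˡ m n a i j = begin
  (suc m C suc a) * (n C suc a) * mono (suc a) k i j
    ≡⟨ cong (λ c → c * (n C suc a) * mono (suc a) k i j) (sym (nCk+nC[k+1]≡[n+1]C[k+1] m a)) ⟩
  ((m C a) + (m C suc a)) * (n C suc a) * mono (suc a) k i j
    ≡⟨ solve 4 (λ p q r s → (p :+ q) :* r :* s := q :* r :* s :+ p :* r :* s) refl (m C a) (m C suc a) (n C suc a) _ ⟩
  (m C suc a) * (n C suc a) * mono (suc a) k i j + (m C a) * (n C suc a) * mono (suc a) k i j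
    ≡⟨ cong₂ _+_ (scale-mulS m n (suc a) (suc a) k _ expo (suc a) i j) part2 ⟩
  mulS (termA m n (suc a)) i j + mulQ (termB m n a) i j
    ∎
  where
  open ≡-Reasoning
  open +-*-Solver
  k : ℕ
  k = suc m + n ∸ 2 * suc a
  expo : suc a ≤ m → suc a ≤ n → k ≡ suc (m + n ∸ 2 * suc a)
  expo p q = +-∸-assoc 1 (+-mono-≤ p (≤-trans (≤-reflexive (+-identityʳ (suc a))) q))
  part2 : (m C a) * (n C suc a) * mono (suc a) k i j ≡ mulQ (termB m n a) i j
  part2 = ≡-trans (cong ((m C a) * (n C suc a) *_) (mono-sucˡ a k i j)) (sym (mulQ-scale ((m C a) * (n C suc a)) (mono a k) i j))

termA-sucˡ-0 : ∀ m n → termA (suc m) n 0 ≐ mulS (termA m n 0)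
termA-sucˡ-0 m n = scale-mulS (suc m) n 0 0 (suc m + n) (m + n) (λ _ _ → refl) 0

-- Pascal's rule for the added y-letter: either it lies outside the factors, or it joins the waiting
-- x-letter. The second case has weight 1, because the q of the factor was charged to the x-letter.
termB-sucʳ : ∀ m n a → termB m (suc n) a ≐ (mulS (termB m n a) +P termA m n a)
termB-sucʳ m n a i j = begin
  (m C a) * (suc n C suc a) * mono a k i j
    ≡⟨ cong (λ c → (m C a) * c * mono a k i j) (sym (nCk+nC[k+1]≡[n+1]C[k+1] n a)) ⟩
  (m C a) * ((n C a) + (n C suc a)) * mono a k i j
    ≡⟨ solve 4 (λ p q r s → p :* (q :+ r) :* s := p :* r :* s :+ p :* q :* s) refl (m C a) (n C a) (n C suc a) _ ⟩
  (m C a) * (n C suc a) * mono a k i j + (m C a) * (n C a) * mono a k i j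
    ≡⟨ cong₂ _+_ (scale-mulS m n a (suc a) k _ expo a i j) (cong (λ l → (m C a) * (n C a) * mono a l i j) shift) ⟩
  mulS (termB m n a) i j + termA m n a i j
    ∎
  where
  open ≡-Reasoning
  open +-*-Solver
  k : ℕ
  k = m + suc n ∸ (a + suc (a + 0))
  shift : k ≡ m + n ∸ 2 * a
  shift = cong₂ _∸_ (+-suc m n) (+-suc a (a + 0))
  expo : a ≤ m → suc a ≤ n → k ≡ suc (m + n ∸ (a + suc (a + 0)))
  expo p q = ≡-trans (cong (_∸ (a + suc (a + 0))) (+-suc m n))
    (+-∸-assoc 1 (+-mono-≤ p (≤-trans (≤-reflexive (cong suc (+-identityʳ a))) q)))

-- The bound N is kept apart from m and n, since the minimum of m and n would change irregularly
-- along the recurrences. Surplus terms vanish with their binomial coefficients.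
sumA sumB : ℕ → ℕ → ℕ → Poly
sumA N m n = ΣP N (termA m n)
sumB N m n = ΣP N (termB m n)

-- The term a = 0 has no factor for the new x-letter to join; splitting it off shifts the index of
-- the remaining sum, whence the bound N in `sumB`.
sumA-sucˡ : ∀ N m n → sumA (suc N) (suc m) n ≐ (mulS (sumA (suc N) m n) +P mulQ (sumB N m n))
sumA-sucˡ N m n i j = begin
  ΣP (suc N) (termA (suc m) n) i j
    ≡⟨ ΣP-suc N _ i j ⟩
  termA (suc m) n 0 i j + ΣP N (termA (suc m) n ∘ suc) i j
    ≡⟨ cong₂ _+_ (termA-sucˡ-0 m n i j) (ΣP-cong N (termA-sucˡ m n) i j) ⟩
  mulS (termA m n 0) i j + ΣP N (λ a → mulS (termA m n (suc a)) +P mulQ (termB m n a)) i j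
    ≡⟨ cong (mulS (termA m n 0) i j +_) (ΣP-+P N _ _ i j) ⟩
  mulS (termA m n 0) i j + (ΣP N (mulS ∘ termA m n ∘ suc) i j + ΣP N (mulQ ∘ termB m n) i j)
    ≡⟨ +-assoc (mulS (termA m n 0) i j) _ _ ⟨
  mulS (termA m n 0) i j + ΣP N (mulS ∘ termA m n ∘ suc) i j + ΣP N (mulQ ∘ termB m n) i j
    ≡⟨ cong₂ _+_ (sym (ΣP-suc N (mulS ∘ termA m n) i j)) (ΣP-mulQ N (termB m n) i j) ⟩
  ΣP (suc N) (mulS ∘ termA m n) i j + mulQ (sumB N m n) i j
    ≡⟨ cong (_+ mulQ (sumB N m n) i j) (ΣP-mulS (suc N) (termA m n) i j) ⟩
  mulS (sumA (suc N) m n) i j + mulQ (sumB N m n) i j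
    ∎
  where open ≡-Reasoning

sumB-sucʳ : ∀ N m n → sumB N m (suc n) ≐ (mulS (sumB N m n) +P sumA N m n)
sumB-sucʳ N m n i j = begin
  ΣP N (termB m (suc n)) i j                               ≡⟨ ΣP-cong N (termB-sucʳ m n) i j ⟩
  ΣP N (λ a → mulS (termB m n a) +P termA m n a) i j       ≡⟨ ΣP-+P N _ _ i j ⟩
  ΣP N (mulS ∘ termB m n) i j + sumA N m n i j             ≡⟨ cong (_+ sumA N m n i j) (ΣP-mulS N (termB m n) i j) ⟩
  mulS (sumB N m n) i j + sumA N m n i j                   ∎
  where open ≡-Reasoning

sumB-zeroʳ : ∀ N m i j → sumB N m 0 i j ≡ 0
sumB-zeroʳ N m i j = ΣP-zero N i j λ a → cong (_* mono a (m + 0 ∸ (a + suc (a + 0))) i j) (*-zeroʳ (m C a))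

sumA-zeroˡ : ∀ N n → sumA N 0 n ≐ (sP ^P n)
sumA-zeroˡ N n i j = begin
  sumA N 0 n i j          ≡⟨ cong (λ k → sumA k 0 n i j) (+-identityʳ N) ⟨
  sumA (N + 0) 0 n i j    ≡⟨ ΣP-truncate 0 N vanish i j ⟩
  1 * mono 0 n i j        ≡⟨ *-identityˡ _ ⟩
  mono 0 n i j            ≡⟨ mono-0 n i j ⟩
  (sP ^P n) i j           ∎
  where
  open ≡-Reasoning
  vanish : ∀ a → 0 < a → ∀ i j → termA 0 n a i j ≡ 0
  vanish (suc a) _ i j = refl

sumA-RHS : ∀ m n → sumA m m n ≐ RHS m n
sumA-RHS m n i j = ≡-trans truncate (ΣP-cong (m ⊓ n) (λ a i j → sym (constP-*P ((m C a) * (n C a)) (mono a (m + n ∸ 2 * a)) i j)) i j)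
  where
  truncate : sumA m m n i j ≡ sumA (m ⊓ n) m n i j
  truncate with ≤-total m n
  ... | inj₁ m≤n rewrite m≤n⇒m⊓n≡m m≤n = refl
  ... | inj₂ n≤m rewrite m≥n⇒m⊓n≡n n≤m = ≡-trans
    (cong (λ k → sumA k m n i j) (sym (m∸n+n≡m n≤m)))
    (ΣP-truncate n (m ∸ n) (λ a n<a i j → cong (_* mono a (m + n ∸ 2 * a) i j)
      (≡-trans (cong ((m C a) *_) (k>n⇒nCk≡0 n<a)) (*-zeroʳ (m C a)))) i j)

sumA-zeroˡ-sucʳ : ∀ N n → sumA N 0 (suc n) ≐ mulS (sumA N 0 n)
sumA-zeroˡ-sucʳ N n i j = begin
  sumA N 0 (suc n) i j        ≡⟨ sumA-zeroˡ N (suc n) i j ⟩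
  (sP *P (sP ^P n)) i j       ≡⟨ sP-*P (sP ^P n) i j ⟩
  mulS (sP ^P n) i j          ≡⟨ mulS-cong (sumA-zeroˡ N n) i j ⟨
  mulS (sumA N 0 n) i j       ∎
  where open ≡-Reasoning

-- Order of the letters in a word

module _ {A : Set} where

  private variable
    a b c d : A
    u v w : List A

  unique-set⇒length : {u v : List A} → Unique u → Unique v → (∀ c → c ∈ u ⇔ c ∈ v) → length u ≡ length v
  unique-set⇒length uu uv eq = ↭-length (∼bag⇒↭ (unique∧set⇒bag uu uv λ {c} → eq c))

  -- An inductive counterpart of `Precedes`: recursion on its proofs replaces equations between
  -- concatenations.
  data Before (a b : A) : List A → Set where
    here  : b ∈ w → Before a b (a ∷ w)
    there : Before a b w → Before a b (c ∷ w)

  before-∈ˡ : Before a b w → a ∈ w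
  before-∈ˡ (here _)  = here refl
  before-∈ˡ (there p) = there (before-∈ˡ p)

  before-∈ʳ : Before a b w → b ∈ w
  before-∈ʳ (here p)  = there p
  before-∈ʳ (there p) = there (before-∈ʳ p)

  before-trans : Unique w → Before a b w → Before b c w → Before a c w
  before-trans u       (here p)  (here q)  = here q
  before-trans u       (here p)  (there q) = here (before-∈ʳ q)
  before-trans u       (there p) (here q)  = contradiction (before-∈ʳ p) (Unique[x∷xs]⇒x∉xs u)
  before-trans (_ ∷ u) (there p) (there q) = there (before-trans u p q)

  before-asym : Unique w → Before a b w → ¬ Before b a w
  before-asym u       (here p)  (here q)  = Unique[x∷xs]⇒x∉xs u q
  before-asym u       (here p)  (there q) = Unique[x∷xs]⇒x∉xs u (before-∈ʳ q)
  before-asym u       (there p) (here q)  = Unique[x∷xs]⇒x∉xs u (before-∈ʳ p)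
  before-asym (_ ∷ u) (there p) (there q) = before-asym u p q

  before-total : a ≢ b → a ∈ w → b ∈ w → Before a b w ⊎ Before b a w
  before-total a≢b (here refl) (here refl) = contradiction refl a≢b
  before-total a≢b (here refl) (there q)   = inj₁ (here q)
  before-total a≢b (there p)   (here refl) = inj₂ (here p)
  before-total a≢b (there p)   (there q)   = [ inj₁ ∘ there , inj₂ ∘ there ]′ (before-total a≢b p q)

  before⇒split : Before a b w → ∃ λ p → ∃ λ q → ∃ λ r → w ≡ p ++ (a ∷ q ++ (b ∷ r))
  before⇒split {a = a} {b = b} (here p) = [] , go p
    where
    go : ∀ {w} → b ∈ w → ∃ λ q → ∃ λ r → a ∷ w ≡ a ∷ q ++ (b ∷ r)
    go (here refl) = [] , _ , refl
    go (there p) with q , r , refl ← go p = _ ∷ q , r , refl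
  before⇒split (there p) with q , r , s , refl ← before⇒split p = _ ∷ q , r , s , refl

  split⇒before : ∀ p q r → Before a b (p ++ (a ∷ q ++ (b ∷ r)))
  split⇒before []      q r = here (∈-++⁺ʳ q (here refl))
  split⇒before (_ ∷ p) q r = there (split⇒before p q r)

  allPairs-before : ∀ {R : A → A → Set} → AllPairs R w → Before a b w → R a b
  allPairs-before (h ∷ _) (here p)  = All.lookup h p
  allPairs-before (_ ∷ t) (there p) = allPairs-before t p

  before-allPairs : ∀ {R : A → A → Set} → (∀ {a b} → Before a b w → R a b) → AllPairs R w
  before-allPairs {w = []}    f = []
  before-allPairs {w = _ ∷ _} f = All.tabulate (f ∘ here) ∷ before-allPairs (f ∘ there)

  -- If the heads a of u and b of v differed, then b would come after a in u and hence in v,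
  -- although v begins with b and repeats no letter.
  order-determines : Unique u → Unique v → (∀ {c} → c ∈ u → c ∈ v) → (∀ {c} → c ∈ v → c ∈ u) →
                     (∀ {a b} → Before a b u → Before a b v) → u ≡ v
  order-determines {[]}    {[]}    uu uv f g h = refl
  order-determines {[]}    {_ ∷ _} uu uv f g h with () ← g (here refl)
  order-determines {_ ∷ _} {[]}    uu uv f g h with () ← f (here refl)
  order-determines {a ∷ u} {b ∷ v} uu uv f g h with heads
    where
    heads : a ≡ b
    heads with f (here refl) | g (here refl)
    ... | here e  | _       = e
    ... | there _ | here e  = sym e
    ... | there _ | there q with h (here q)
    ...   | here _  = refl
    ...   | there r = contradiction (before-∈ʳ r) (Unique[x∷xs]⇒x∉xs uv)
  ... | refl = cong (a ∷_) (order-determines (AllPairs.tail uu) (AllPairs.tail uv) f' g' h')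
    where
    f' : ∀ {c} → c ∈ u → c ∈ v
    f' p with f (there p)
    ... | here refl = contradiction p (Unique[x∷xs]⇒x∉xs uu)
    ... | there q   = q
    g' : ∀ {c} → c ∈ v → c ∈ u
    g' p with g (there p)
    ... | here refl = contradiction p (Unique[x∷xs]⇒x∉xs uv)
    ... | there q   = q
    h' : ∀ {c d} → Before c d u → Before c d v
    h' p with h (there p)
    ... | here _  = contradiction (before-∈ˡ p) (Unique[x∷xs]⇒x∉xs uu)
    ... | there q = q

  -- Deletion as a relation, like `Swap` below, so that facts about a move deep inside a word follow
  -- by structural recursion.
  data Remove (c : A) : List A → List A → Set where
    here  : Remove c (c ∷ w) w
    there : Remove c v w → Remove c (d ∷ v) (d ∷ w)

  remove-++ : ∀ p {s} → Remove c (p ++ c ∷ s) (p ++ s)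
  remove-++ []      = here
  remove-++ (_ ∷ p) = there (remove-++ p)

  remove-∈ : Remove c v w → c ∈ v
  remove-∈ here      = here refl
  remove-∈ (there r) = there (remove-∈ r)

  remove-⊇ : Remove c v w → a ∈ w → a ∈ v
  remove-⊇ here      p           = there p
  remove-⊇ (there r) (here refl) = here refl
  remove-⊇ (there r) (there p)   = there (remove-⊇ r p)

  remove-⊆ : Remove c v w → a ∈ v → a ≡ c ⊎ a ∈ w
  remove-⊆ here      (here refl) = inj₁ refl
  remove-⊆ here      (there p)   = inj₂ p
  remove-⊆ (there r) (here refl) = inj₂ (here refl)
  remove-⊆ (there r) (there p)   = [ inj₁ , inj₂ ∘ there ]′ (remove-⊆ r p)

  remove-∉ : Unique v → Remove c v w → c ∉ w
  remove-∉ u       here      p           = Unique[x∷xs]⇒x∉xs u p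
  remove-∉ u       (there r) (here refl) = Unique[x∷xs]⇒x∉xs u (remove-∈ r)
  remove-∉ (_ ∷ u) (there r) (there p)   = remove-∉ u r p

  remove-before⁺ : Remove c v w → Before a b w → Before a b v
  remove-before⁺ here      p         = there p
  remove-before⁺ (there r) (here p)  = here (remove-⊇ r p)
  remove-before⁺ (there r) (there p) = there (remove-before⁺ r p)

  remove-before⁻ : Remove c v w → a ≢ c → b ≢ c → Before a b v → Before a b w
  remove-before⁻ here      a≢c b≢c (here p)  = contradiction refl a≢c
  remove-before⁻ here      a≢c b≢c (there p) = p
  remove-before⁻ (there r) a≢c b≢c (here p)  = [ (λ e → contradiction e b≢c) , here ]′ (remove-⊆ r p)
  remove-before⁻ (there r) a≢c b≢c (there p) = there (remove-before⁻ r a≢c b≢c p)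

  remove-allPairs : ∀ {R : A → A → Set} → Remove c v w → AllPairs R v → AllPairs R w
  remove-allPairs here      (_ ∷ t) = t
  remove-allPairs (there r) (h ∷ t) = All.tabulate (All.lookup h ∘ remove-⊇ r) ∷ remove-allPairs r t

  data Swap (a b : A) : List A → List A → Set where
    here  : Swap a b (a ∷ b ∷ w) (b ∷ a ∷ w)
    there : Swap a b v w → Swap a b (d ∷ v) (d ∷ w)

  swap-++ : ∀ p {s} → Swap a b (p ++ a ∷ b ∷ s) (p ++ b ∷ a ∷ s)
  swap-++ []      = here
  swap-++ (_ ∷ p) = there (swap-++ p)

  swap-sym : Swap a b v w → Swap b a w v
  swap-sym here      = here
  swap-sym (there s) = there (swap-sym s)

  swap-∈ : Swap a b v w → c ∈ v → c ∈ w
  swap-∈ here      (here p)         = there (here p)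
  swap-∈ here      (there (here p)) = here p
  swap-∈ here      (there (there p)) = there (there p)
  swap-∈ (there s) (here p)         = here p
  swap-∈ (there s) (there p)        = there (swap-∈ s p)

  swap-before : Swap a b v w → Before c d v → (c ≡ a × d ≡ b) ⊎ Before c d w
  swap-before here      (here (here refl)) = inj₁ (refl , refl)
  swap-before here      (here (there p))   = inj₂ (there (here p))
  swap-before here      (there (here p))   = inj₂ (here (there p))
  swap-before here      (there (there p))  = inj₂ (there (there p))
  swap-before (there s) (here p)           = inj₂ (here (swap-∈ s p))
  swap-before (there s) (there p)          = [ inj₁ , inj₂ ∘ there ]′ (swap-before s p)

  swap-before-self : Swap a b v w → Before a b v
  swap-before-self here      = here (here refl)
  swap-before-self (there s) = there (swap-before-self s)

  swap-allPairs : ∀ {R : A → A → Set} → R b a → Swap a b v w → AllPairs R v → AllPairs R w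
  swap-allPairs r here      ((_ ∷ ha) ∷ hb ∷ t) = (r ∷ hb) ∷ ha ∷ t
  swap-allPairs r (there s) (h ∷ t) =
    All.tabulate (All.lookup h ∘ swap-∈ (swap-sym s)) ∷ swap-allPairs r s t

Increasing : ∀ {k} → List (Fin k) → Set
Increasing = AllPairs Fin._<_

increasing⇒∉ : ∀ {k} {a : Fin k} {l} → Increasing (a ∷ l) → a ∉ l
increasing⇒∉ (h ∷ _) p = ℕ.<-irrefl refl (All.lookup h p)

-- Shuffle words and the bubble order

module _ {m n : ℕ} where

  private variable
    i k : Fin m
    j l : Fin n
    a b c : Letter m n
    u u' v w s : Word m n

  infix 4 _≺_
  -- Letters of different alphabets are related both ways, which leaves their mutual order free. The
  -- relation is therefore not transitive, and `Sorted` has to ask for it on all pairs, not just on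
  -- neighbours. Irreflexivity excludes repeated letters.
  data _≺_ : Letter m n → Letter m n → Set where
    xx : i Fin.< k → x i ≺ x k
    yy : j Fin.< l → y j ≺ y l
    xy : x i ≺ y j
    yx : y j ≺ x i

  ≺⇒≢ : a ≺ b → a ≢ b
  ≺⇒≢ (xx p) refl = ℕ.<-irrefl refl p
  ≺⇒≢ (yy p) refl = ℕ.<-irrefl refl p

  _≟_ : DecidableEquality (Letter m n)
  x i ≟ x k with i Fin.≟ k
  ... | yes refl = yes refl
  ... | no i≢k   = no λ { refl → i≢k refl }
  x _ ≟ y _ = no λ ()
  y _ ≟ x _ = no λ ()
  y j ≟ y l with j Fin.≟ l
  ... | yes refl = yes refl
  ... | no j≢l   = no λ { refl → j≢l refl }

  open DecMembership _≟_ using (_∈?_)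

  Sorted : Word m n → Set
  Sorted = AllPairs _≺_

  sorted⇒unique : Sorted w → Unique w
  sorted⇒unique = AllPairs.map ≺⇒≢

  sorted-before : Sorted w → ¬ b ≺ a → a ≢ b → a ∈ w → b ∈ w → Before a b w
  sorted-before s b⊀a a≢b p q with before-total a≢b p q
  ... | inj₁ r = r
  ... | inj₂ r = contradiction (allPairs-before s r) b⊀a

  sorted-before-xx : Sorted w → i Fin.< k → x i ∈ w → x k ∈ w → Before (x i) (x k) w
  sorted-before-xx s i<k = sorted-before s (λ { (xx k<i) → ℕ.<-asym i<k k<i }) (≺⇒≢ (xx i<k))

  sorted-before-yy : Sorted w → j Fin.< l → y j ∈ w → y l ∈ w → Before (y j) (y l) w
  sorted-before-yy s j<l = sorted-before s (λ { (yy l<j) → ℕ.<-asym j<l l<j }) (≺⇒≢ (yy j<l))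

  shuffle⇒sorted : IsShuffle w → Sorted w
  shuffle⇒sorted {w} (un , sx , sy) = before-allPairs before⇒≺
    where
    before⇒≺ : ∀ {a b} → Before a b w → a ≺ b
    before⇒≺ {x i} {x k} p with Fin.<-cmp i k
    ... | tri< i<k _ _ = xx i<k
    ... | tri≈ _ refl _ = contradiction p (before-asym un p)
    ... | tri> _ _ k<i with q , r , s , e ← sx k i k<i (before-∈ʳ p) (before-∈ˡ p) =
      contradiction (subst (Before (x k) (x i)) (sym e) (split⇒before q r s)) (before-asym un p)
    before⇒≺ {x i} {y j} p = xy
    before⇒≺ {y j} {x i} p = yx
    before⇒≺ {y j} {y l} p with Fin.<-cmp j l
    ... | tri< j<l _ _ = yy j<l
    ... | tri≈ _ refl _ = contradiction p (before-asym un p)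
    ... | tri> _ _ l<j with q , r , s , e ← sy l j l<j (before-∈ʳ p) (before-∈ˡ p) =
      contradiction (subst (Before (y l) (y j)) (sym e) (split⇒before q r s)) (before-asym un p)

  sorted⇒shuffle : Sorted w → IsShuffle w
  sorted⇒shuffle s = sorted⇒unique s
    , (λ i k i<k p q → before⇒split (sorted-before-xx s i<k p q))
    , (λ j l j<l p q → before⇒split (sorted-before-yy s j<l p q))

  -- The order of Bub(m,n) seen on every pair x i, y j separately; its antisymmetry
  -- and the one-step arguments below replace a rank function, as Bub(m,n) is not graded.
  infix 4 _⊑_
  record _⊑_ (u v : Word m n) : Set where
    field
      xs⊇ : ∀ {i} → x i ∈ v → x i ∈ u
      ys⊆ : ∀ {j} → y j ∈ u → y j ∈ v
      inv : ∀ {i j} → x i ∈ v → Before (y j) (x i) u → Before (y j) (x i) v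
  open _⊑_

  ⊑-refl : u ⊑ u
  ⊑-refl = record { xs⊇ = id ; ys⊆ = id ; inv = λ _ p → p }

  ⊑-trans : u ⊑ v → v ⊑ w → u ⊑ w
  ⊑-trans p q = record
    { xs⊇ = xs⊇ p ∘ xs⊇ q
    ; ys⊆ = ys⊆ q ∘ ys⊆ p
    ; inv = λ r → inv q r ∘ inv p (xs⊇ q r)
    }

  -- The two words have the same letters, the order inside each alphabet is fixed by the indices,
  -- and the mixed pairs are inverted in u exactly when they are inverted in v.
  ⊑-antisym : Sorted u → Sorted v → u ⊑ v → v ⊑ u → u ≡ v
  ⊑-antisym {u} {v} su sv p q = order-determines (sorted⇒unique su) (sorted⇒unique sv) to from order
    where
    to : ∀ {c} → c ∈ u → c ∈ v
    to {x i} = xs⊇ q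
    to {y j} = ys⊆ p
    from : ∀ {c} → c ∈ v → c ∈ u
    from {x i} = xs⊇ p
    from {y j} = ys⊆ q
    order : ∀ {a b} → Before a b u → Before a b v
    order {x i} {x k} r with allPairs-before su r
    ... | xx i<k = sorted-before-xx sv i<k (to (before-∈ˡ r)) (to (before-∈ʳ r))
    order {y j} {y l} r with allPairs-before su r
    ... | yy j<l = sorted-before-yy sv j<l (to (before-∈ˡ r)) (to (before-∈ʳ r))
    order {y j} {x i} r = inv p (to (before-∈ʳ r)) r
    order {x i} {y j} r with before-total {a = x i} {b = y j} (λ ()) (to (before-∈ˡ r)) (to (before-∈ʳ r))
    ... | inj₁ t = t
    ... | inj₂ t = contradiction (inv q (before-∈ˡ r) t) (before-asym (sorted⇒unique su) r)

  -- Deleting an x-letter destroys its inversions, but the premise `x i ∈ v` of `inv` exempts these.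
  removeX⇒⊑ : Sorted u → Remove (x i) u v → u ⊑ v
  removeX⇒⊑ su r = record
    { xs⊇ = remove-⊇ r
    ; ys⊆ = λ p → [ (λ ()) , id ]′ (remove-⊆ r p)
    ; inv = λ p → remove-before⁻ r (λ ()) λ { refl → remove-∉ (sorted⇒unique su) r p }
    }

  removeY⇒⊑ : Remove (y j) v u → u ⊑ v
  removeY⇒⊑ r = record
    { xs⊇ = λ p → [ (λ ()) , id ]′ (remove-⊆ r p)
    ; ys⊆ = remove-⊇ r
    ; inv = λ _ → remove-before⁺ r
    }

  swap⇒⊑ : Swap (x i) (y j) u v → u ⊑ v
  swap⇒⊑ s = record
    { xs⊇ = swap-∈ (swap-sym s)
    ; ys⊆ = swap-∈ s
    ; inv = λ _ p → [ (λ { (() , _) }) , id ]′ (swap-before s p)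
    }

  move⇒⊑ : Sorted u → Move u v → u ⊑ v
  move⇒⊑ su (delX p s i)    = removeX⇒⊑ su (remove-++ p)
  move⇒⊑ su (insY p s j)    = removeY⇒⊑ (remove-++ p)
  move⇒⊑ su (trans p s i j) = swap⇒⊑ (swap-++ p)

  ≤Bub⇒⊑ : u ≤Bub v → u ⊑ v
  ≤Bub⇒⊑ ε                   = ⊑-refl
  ≤Bub⇒⊑ ((su , _ , mv) ◅ r) = ⊑-trans (move⇒⊑ (shuffle⇒sorted su) mv) (≤Bub⇒⊑ r)

  move-irrefl : Sorted u → Sorted v → Move u v → u ≢ v
  move-irrefl su sv (delX p s i) e =
    remove-∉ (sorted⇒unique su) (remove-++ p) (subst (x i ∈_) e (remove-∈ (remove-++ p {s})))
  move-irrefl su sv (insY p s j) e =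
    remove-∉ (sorted⇒unique sv) (remove-++ p) (subst (y j ∈_) (sym e) (remove-∈ (remove-++ p {s})))
  move-irrefl su sv (trans p s i j) e = before-asym (sorted⇒unique sv)
    (subst (Before (x i) (y j)) e (swap-before-self (swap-++ p)))
    (swap-before-self (swap-sym (swap-++ p)))

  move-++ : ∀ p → Move u v → Move (p ++ u) (p ++ v)
  move-++ []      mv = mv
  move-++ (c ∷ p) mv = cons (move-++ p mv)
    where
    cons : ∀ {u v} → Move u v → Move (c ∷ u) (c ∷ v)
    cons (delX p s i)    = delX (c ∷ p) s i
    cons (insY p s j)    = insY (c ∷ p) s j
    cons (trans p s i j) = trans (c ∷ p) s i j

  -- Lower covers

  -- An x-letter that moves right across y-letters moves up in the order. The rightmost admissible
  -- place for x i thus gives the largest of the words obtained by inserting it.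
  data CoverX (i : Fin m) : Word m n → Word m n → Set where
    end   : CoverX i (x i ∷ []) []
    next  : CoverX i (x i ∷ x k ∷ s) (x k ∷ s)
    there : CoverX i v w → CoverX i (c ∷ v) (c ∷ w)

  data CoverY (j : Fin n) : Word m n → Word m n → Set where
    end   : CoverY j [] (y j ∷ [])
    next  : CoverY j (y l ∷ s) (y j ∷ y l ∷ s)
    there : CoverY j v w → CoverY j (c ∷ v) (c ∷ w)

  coverX⇒remove : CoverX i v w → Remove (x i) v w
  coverX⇒remove end       = here
  coverX⇒remove next      = here
  coverX⇒remove (there r) = there (coverX⇒remove r)

  coverY⇒remove : CoverY j v w → Remove (y j) w v
  coverY⇒remove end       = here
  coverY⇒remove next      = here
  coverY⇒remove (there r) = there (coverY⇒remove r)

  -- The letter directly after x i, if there is one, is an x-letter, and it separates x i from every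
  -- later y-letter.
  coverX-gap : Sorted v → CoverX i v w → Before (x i) (y j) v →
               ∃ λ k → Before (x i) (x k) v × Before (x k) (y j) v
  coverX-gap s end  (there ())
  coverX-gap s next (here (here ()))
  coverX-gap s next (here (there p)) = _ , here (here refl) , there (here p)
  coverX-gap s next (there p) =
    contradiction (before-∈ˡ p) (Unique[x∷xs]⇒x∉xs (sorted⇒unique s))
  coverX-gap s (there r) (here p) =
    contradiction (remove-∈ (coverX⇒remove r)) (Unique[x∷xs]⇒x∉xs (sorted⇒unique s))
  coverX-gap (_ ∷ s) (there r) (there p) with k , q , t ← coverX-gap s r p = k , there q , there t

  coverY-gap : Sorted w → CoverY j v w → Before (y j) (x i) w →
               ∃ λ l → Before (y j) (y l) w × Before (y l) (x i) w
  coverY-gap s end  (there ())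
  coverY-gap s next (here (here ()))
  coverY-gap s next (here (there p)) = _ , here (here refl) , there (here p)
  coverY-gap s next (there p) =
    contradiction (before-∈ˡ p) (Unique[x∷xs]⇒x∉xs (sorted⇒unique s))
  coverY-gap s (there r) (here p) =
    contradiction (remove-∈ (coverY⇒remove r)) (Unique[x∷xs]⇒x∉xs (sorted⇒unique s))
  coverY-gap (_ ∷ s) (there r) (there p) with l , q , t ← coverY-gap s r p = l , there q , there t

  data Cover (u' u : Word m n) : Set where
    coverX : CoverX i u' u → Cover u' u
    coverY : CoverY j u' u → Cover u' u
    coverT : Swap (x i) (y j) u' u → Cover u' u

  cover⇒move : Cover u' u → Move u' u
  cover⇒move (coverX r) = goX r
    where
    goX : ∀ {u' u} → CoverX i u' u → Move u' u
    goX end       = delX [] [] _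
    goX next      = delX [] _ _
    goX (there r) = move-++ (_ ∷ []) (goX r)
  cover⇒move (coverY r) = goY r
    where
    goY : ∀ {u' u} → CoverY j u' u → Move u' u
    goY end       = insY [] [] _
    goY next      = insY [] _ _
    goY (there r) = move-++ (_ ∷ []) (goY r)
  cover⇒move (coverT r) = goT r
    where
    goT : ∀ {u' u} → Swap (x i) (y j) u' u → Move u' u
    goT here      = trans [] _ _ _
    goT (there r) = move-++ (_ ∷ []) (goT r)

  -- A move that is not listed in Cover drags a letter across a letter of the
  -- other alphabet, and factors through the word where the two are merely swapped.
  cover-or-factor : Sorted u → Sorted v → Move u v →
                    Cover u v ⊎ ∃ λ w → Sorted w × Move u w × Move w v
  cover-or-factor su sv (delX p [] i)        = inj₁ (coverX (go p))
    where
    go : ∀ p → CoverX i (p ++ x i ∷ []) (p ++ [])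
    go []      = end
    go (_ ∷ p) = there (go p)
  cover-or-factor su sv (delX p (x k ∷ s) i) = inj₁ (coverX (go p))
    where
    go : ∀ p → CoverX i (p ++ x i ∷ x k ∷ s) (p ++ x k ∷ s)
    go []      = next
    go (_ ∷ p) = there (go p)
  cover-or-factor su sv (delX p (y j ∷ s) i) = inj₂
    (_ , swap-allPairs yx (swap-++ p) su , trans p s i j , move-++ p (delX (y j ∷ []) s i))
  cover-or-factor su sv (insY p [] j)        = inj₁ (coverY (go p))
    where
    go : ∀ p → CoverY j (p ++ []) (p ++ y j ∷ [])
    go []      = end
    go (_ ∷ p) = there (go p)
  cover-or-factor su sv (insY p (y l ∷ s) j) = inj₁ (coverY (go p))
    where
    go : ∀ p → CoverY j (p ++ y l ∷ s) (p ++ y j ∷ y l ∷ s)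
    go []      = next
    go (_ ∷ p) = there (go p)
  cover-or-factor su sv (insY p (x i ∷ s) j) = inj₂
    (_ , swap-allPairs xy (swap-++ p) sv , move-++ p (insY (x i ∷ []) s j) , trans p s i j)
  cover-or-factor su sv (trans p s i j)      = inj₁ (coverT (swap-++ p))

  -- A single yes-or-no question separates u' from u: whether x i, respectively y j, occurs in w, or
  -- whether the swapped pair is inverted in w. The answer decides on which side w falls.
  cover-adjacent : Sorted u' → Sorted u → Sorted w → Cover u' u → u' ⊑ w → w ⊑ u → w ⊑ u' ⊎ u ⊑ w
  cover-adjacent {u'} {u} {w} su' su sw (coverX {i = i} c) p q with x i ∈? w
  ... | no i∉w = inj₂ record
    { xs⊇ = λ t → [ (λ { refl → contradiction t i∉w }) , id ]′ (remove-⊆ r (xs⊇ p t))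
    ; ys⊆ = ys⊆ p ∘ remove-⊇ r
    ; inv = λ t → inv p t ∘ remove-before⁺ r
    }
    where
    r : Remove (x i) u' u
    r = coverX⇒remove c
  ... | yes i∈w = inj₁ record
    { xs⊇ = λ t → [ (λ { refl → i∈w }) , xs⊇ q ]′ (remove-⊆ r t)
    ; ys⊆ = remove-⊇ r ∘ ys⊆ q
    ; inv = λ t b → [ (λ { refl → self b }) , (λ t' → remove-before⁺ r (inv q t' b)) ]′ (remove-⊆ r t)
    }
    where
    r : Remove (x i) u' u
    r = coverX⇒remove c
    self : ∀ {j} → Before (y j) (x i) w → Before (y j) (x i) u'
    self {j} b with before-total {a = y j} {b = x i} (λ ()) (remove-⊇ r (ys⊆ q (before-∈ˡ b))) (remove-∈ r)
    ... | inj₁ t = t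
    -- Otherwise some x k lies between x i and y j in u'. In w it comes after x i and so after y j;
    -- this inversion passes to u and to u', where y j comes after x k.
    ... | inj₂ t with k , ik , kj ← coverX-gap su' c t with allPairs-before su' ik
    ...   | xx i<k = contradiction
      (remove-before⁺ r (inv q k∈u
        (before-trans (sorted⇒unique sw) b (sorted-before-xx sw i<k i∈w (xs⊇ q k∈u)))))
      (before-asym (sorted⇒unique su') kj)
      where
      k∈u : x k ∈ u
      k∈u = [ (λ { refl → contradiction i<k (ℕ.<-irrefl refl) }) , id ]′ (remove-⊆ r (before-∈ʳ ik))
  cover-adjacent {u'} {u} {w} su' su sw (coverY {j = j} c) p q with y j ∈? w
  ... | no j∉w = inj₁ record
    { xs⊇ = xs⊇ q ∘ remove-⊇ r
    ; ys⊆ = λ t → [ (λ { refl → contradiction t j∉w }) , id ]′ (remove-⊆ r (ys⊆ q t))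
    ; inv = λ t b → remove-before⁻ r (λ { refl → j∉w (before-∈ˡ b) }) (λ ()) (inv q (remove-⊇ r t) b)
    }
    where
    r : Remove (y j) u u'
    r = coverY⇒remove c
  ... | yes j∈w = inj₂ record
    { xs⊇ = remove-⊇ r ∘ xs⊇ p
    ; ys⊆ = λ t → [ (λ { refl → j∈w }) , ys⊆ p ]′ (remove-⊆ r t)
    ; inv = before
    }
    where
    r : Remove (y j) u u'
    r = coverY⇒remove c
    before : ∀ {i l} → x i ∈ w → Before (y l) (x i) u → Before (y l) (x i) w
    before {i} {l} t b with y l ≟ y j
    ... | no l≢j = inv p t (remove-before⁻ r l≢j (λ ()) b)
    -- The inversion of y j and x i is inherited from a y k between them: y k precedes x i already
    -- in u', hence in w, and y j precedes y k in w by the order of the indices.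
    ... | yes refl with k , jk , ki ← coverY-gap su c b with allPairs-before su jk
    ...   | yy j<k = before-trans (sorted⇒unique sw) (sorted-before-yy sw j<k j∈w (before-∈ˡ k-i)) k-i
      where
      k-i : Before (y k) (x i) w
      k-i = inv p t (remove-before⁻ r (λ e → ≺⇒≢ (yy j<k) (sym e)) (λ ()) ki)
  cover-adjacent {u'} {u} {w} su' su sw (coverT {i = i} {j = j} s) p q = decide inverted?
    where
    inverted? : Before (y j) (x i) w ⊎ ¬ Before (y j) (x i) w
    inverted? with before-total {a = y j} {b = x i} (λ ())
                     (ys⊆ p (before-∈ʳ (swap-before-self s))) (xs⊇ q (before-∈ʳ (swap-before-self (swap-sym s))))
    ... | inj₁ t = inj₁ t
    ... | inj₂ t = inj₂ (before-asym (sorted⇒unique sw) t)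
    decide : Before (y j) (x i) w ⊎ ¬ Before (y j) (x i) w → w ⊑ u' ⊎ u ⊑ w
    decide (inj₁ b) = inj₂ record
      { xs⊇ = swap-∈ s ∘ xs⊇ p
      ; ys⊆ = ys⊆ p ∘ swap-∈ (swap-sym s)
      ; inv = λ t b' → [ (λ { (refl , refl) → b }) , inv p t ]′ (swap-before (swap-sym s) b')
      }
    decide (inj₂ ¬b) = inj₁ record
      { xs⊇ = xs⊇ q ∘ swap-∈ s
      ; ys⊆ = swap-∈ (swap-sym s) ∘ ys⊆ q
      ; inv = λ t b' → [ (λ { (refl , refl) → contradiction b' ¬b }) , id ]′
                         (swap-before (swap-sym s) (inv q (swap-∈ s t) b'))
      }

  cover⇒⋖ : Sorted u' → Sorted u → Cover u' u → u' ⋖ u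
  cover⇒⋖ {u'} {u} su' su c = sh' , (sh' , sh , cover⇒move c) ◅ ε , move-irrefl su' su (cover⇒move c) , between
    where
    sh' : IsShuffle u'
    sh' = sorted⇒shuffle su'
    sh : IsShuffle u
    sh = sorted⇒shuffle su
    between : ∀ w → IsShuffle w → u' ≤Bub w → w ≤Bub u → w ≡ u' ⊎ w ≡ u
    between w shw p q with sw ← shuffle⇒sorted shw with cover-adjacent su' su sw c (≤Bub⇒⊑ p) (≤Bub⇒⊑ q)
    ... | inj₁ w⊑u' = inj₁ (⊑-antisym sw su' w⊑u' (≤Bub⇒⊑ p))
    ... | inj₂ u⊑w  = inj₂ (⊑-antisym sw su (≤Bub⇒⊑ q) u⊑w)

  -- Only the start of the chain matters: the word after one move lies between u' and u and differs
  -- from u', so it is u. That move cannot factor, as the intermediate word would lie strictly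
  -- between.
  ⋖⇒cover : Sorted u → u' ⋖ u → Cover u' u
  ⋖⇒cover su (sh' , ε , u'≢u , _) = contradiction refl u'≢u
  ⋖⇒cover {u} {u'} su (sh' , (_ , shw , mv) ◅ r , u'≢u , between)
    with between _ shw ((sh' , shw , mv) ◅ ε) r
  ... | inj₁ refl = contradiction refl (move-irrefl (shuffle⇒sorted sh') (shuffle⇒sorted sh') mv)
  ... | inj₂ refl with cover-or-factor (shuffle⇒sorted sh') su mv
  ...   | inj₁ c = c
  ...   | inj₂ (w , sw , mv₁ , mv₂)
    with between w (sorted⇒shuffle sw) ((sh' , sorted⇒shuffle sw , mv₁) ◅ ε) ((sorted⇒shuffle sw , sorted⇒shuffle su , mv₂) ◅ ε)
  ...     | inj₁ e = contradiction (sym e) (move-irrefl (shuffle⇒sorted sh') sw mv₁)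
  ...     | inj₂ e = contradiction e (move-irrefl sw su mv₂)

  -- Cardinalities of sets of words

  private variable
    P Q : Word m n → Set
    p q : ℕ

  card-⇔ : (∀ {w} → P w → Q w) → (∀ {w} → Q w → P w) → HasCard P p → HasCard Q p
  card-⇔ f g (L , uL , spec , e) =
    L , uL , (λ w → mk⇔ (f ∘ Equivalence.to (spec w)) (Equivalence.from (spec w) ∘ g)) , e

  card-∅ : (∀ {w} → ¬ P w) → HasCard P 0
  card-∅ f = [] , [] , (λ w → mk⇔ (λ ()) (⊥-elim ∘ f)) , refl

  card-⊎ : (∀ {w} → P w → ¬ Q w) → HasCard P p → HasCard Q q → HasCard (λ w → P w ⊎ Q w) (p + q)
  card-⊎ disjoint (L , uL , specL , refl) (M , uM , specM , refl) = L ++ M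
    , ++⁺ uL uM (λ { {w} (r , t) → disjoint (Equivalence.to (specL w) r) (Equivalence.to (specM w) t) })
    , (λ w → mk⇔
        ([ inj₁ ∘ Equivalence.to (specL w) , inj₂ ∘ Equivalence.to (specM w) ]′ ∘ ∈-++⁻ L)
        [ ∈-++⁺ˡ ∘ Equivalence.from (specL w) , ∈-++⁺ʳ L ∘ Equivalence.from (specM w) ]′)
    , length-++ L

  Image : (Word m n → Word m n) → (Word m n → Set) → Word m n → Set
  Image f P w = ∃ λ v → w ≡ f v × P v

  card-image : ∀ f → (∀ {v w} → f v ≡ f w → v ≡ w) → HasCard P p → HasCard (Image f P) p
  card-image f inj (L , uL , spec , refl) = map f L , map⁺ inj uL
    , (λ w → mk⇔
        (λ r → let v , v∈L , e = ∈-map⁻ f r in v , e , Equivalence.to (spec v) v∈L)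
        (λ { (v , refl , pv) → ∈-map⁺ f (Equivalence.from (spec v) pv) }))
    , length-map f L

  card-unique : HasCard P p → HasCard P q → p ≡ q
  card-unique (L , uL , specL , refl) (M , uM , specM , refl) = unique-set⇒length uL uM λ w → mk⇔
    (Equivalence.from (specM w) ∘ Equivalence.to (specL w))
    (Equivalence.from (specL w) ∘ Equivalence.to (specM w))

  -- Listing and counting the lower covers

  insertX : Fin m → Word m n → Word m n
  insertX i []        = x i ∷ []
  insertX i (y j ∷ w) = y j ∷ insertX i w
  insertX i (x k ∷ w) with i Fin.<? k
  ... | yes _ = x i ∷ x k ∷ w
  ... | no  _ = x k ∷ insertX i w

  insertX-coverX : ∀ i w → CoverX i (insertX i w) w
  insertX-coverX i []        = end
  insertX-coverX i (y j ∷ w) = there (insertX-coverX i w)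
  insertX-coverX i (x k ∷ w) with i Fin.<? k
  ... | yes _ = next
  ... | no  _ = there (insertX-coverX i w)

  -- Were x i to stand beyond a larger x-letter, or directly before a smaller one, u' would not be
  -- sorted; this leaves a single place.
  coverX⇒insertX : Sorted u' → CoverX i u' u → u' ≡ insertX i u
  coverX⇒insertX s end = refl
  coverX⇒insertX {i = i} ((xx i<k ∷ _) ∷ _) (next {k = k}) with i Fin.<? k
  ... | yes _  = refl
  ... | no i≮k = contradiction i<k i≮k
  coverX⇒insertX (_ ∷ s) (there {c = y j} r) = cong (y j ∷_) (coverX⇒insertX s r)
  coverX⇒insertX {i = i} (h ∷ s) (there {c = x k} r) with i Fin.<? k | All.lookup h (remove-∈ (coverX⇒remove r))
  ... | yes i<k | xx k<i = contradiction k<i (ℕ.<-asym i<k)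
  ... | no  _   | _      = cong (x k ∷_) (coverX⇒insertX s r)

  insertX-sorted : Sorted w → x i ∉ w → Sorted (insertX i w)
  insertX-sorted {[]} s i∉w = [] ∷ []
  insertX-sorted {y j ∷ w} {i} (h ∷ s) i∉w = All.tabulate all ∷ insertX-sorted s (i∉w ∘ there)
    where
    all : ∀ {c} → c ∈ insertX i w → y j ≺ c
    all p with remove-⊆ (coverX⇒remove (insertX-coverX i w)) p
    ... | inj₁ refl = yx
    ... | inj₂ q    = All.lookup h q
  insertX-sorted {x k ∷ w} {i} (h ∷ s) i∉w with i Fin.<? k
  ... | yes i<k = (xx i<k ∷ All.map weaken h) ∷ h ∷ s
    where
    weaken : ∀ {c} → x k ≺ c → x i ≺ c
    weaken (xx k<l) = xx (ℕ.<-trans i<k k<l)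
    weaken xy       = xy
  ... | no i≮k = All.tabulate all ∷ insertX-sorted s (i∉w ∘ there)
    where
    all : ∀ {c} → c ∈ insertX i w → x k ≺ c
    all p with remove-⊆ (coverX⇒remove (insertX-coverX i w)) p
    ... | inj₂ q    = All.lookup h q
    ... | inj₁ refl with Fin.<-cmp i k
    ...   | tri< i<k _ _  = contradiction i<k i≮k
    ...   | tri≈ _ refl _ = contradiction (here refl) i∉w
    ...   | tri> _ _ k<i  = xx k<i

  missing : Word m n → List (Fin m)
  missing u = filter (λ i → ¬? (x i ∈? u)) (allFin m)

  xsOf : Word m n → List (Fin m)
  xsOf []        = []
  xsOf (x i ∷ w) = i ∷ xsOf w
  xsOf (y j ∷ w) = xsOf w

  countY : Word m n → ℕ
  countY []        = 0
  countY (x i ∷ w) = countY w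
  countY (y j ∷ w) = suc (countY w)

  xsOf-∈⁺ : x i ∈ w → i ∈ xsOf w
  xsOf-∈⁺ {w = x _ ∷ _} (here refl) = here refl
  xsOf-∈⁺ {w = x _ ∷ _} (there p)   = there (xsOf-∈⁺ p)
  xsOf-∈⁺ {w = y _ ∷ _} (there p)   = xsOf-∈⁺ p

  xsOf-∈⁻ : i ∈ xsOf w → x i ∈ w
  xsOf-∈⁻ {w = x _ ∷ _} (here refl) = here refl
  xsOf-∈⁻ {w = x _ ∷ _} (there p)   = there (xsOf-∈⁻ p)
  xsOf-∈⁻ {w = y _ ∷ _} p           = there (xsOf-∈⁻ p)

  xsOf-unique : Unique w → Unique (xsOf w)
  xsOf-unique {[]} u = []
  xsOf-unique {y _ ∷ w} (_ ∷ u) = xsOf-unique u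
  xsOf-unique {x i ∷ w} u@(_ ∷ t) =
    All.tabulate (λ { p refl → Unique[x∷xs]⇒x∉xs u (xsOf-∈⁻ p) }) ∷ xsOf-unique t

  length-missing : Unique u → length (missing u) + length (xsOf u) ≡ m
  length-missing {u} uu = begin
    length (missing u) + length (xsOf u)   ≡⟨ length-++ (missing u) ⟨
    length (missing u ++ xsOf u)           ≡⟨ unique-set⇒length
                                                (++⁺ (filter⁺ absent? (allFin⁺ m)) (xsOf-unique uu) disjoint)
                                                (allFin⁺ m) (λ i → mk⇔ (λ _ → ∈-allFin i) (λ _ → cover i)) ⟩
    length (allFin m)                      ≡⟨ length-tabulate id ⟩
    m                                      ∎
    where
    open ≡-Reasoning
    absent? : ∀ i → Dec (x i ∉ u)
    absent? i = ¬? (x i ∈? u)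
    disjoint : ∀ {i} → ¬ (i ∈ missing u × i ∈ xsOf u)
    disjoint (p , q) = proj₂ (∈-filter⁻ absent? {xs = allFin m} p) (xsOf-∈⁻ q)
    cover : ∀ i → i ∈ missing u ++ xsOf u
    cover i with x i ∈? u
    ... | yes p = ∈-++⁺ʳ (missing u) (xsOf-∈⁺ p)
    ... | no ¬p = ∈-++⁺ˡ (∈-filter⁺ absent? (∈-allFin i) ¬p)

  coversX coversY coversT : Word m n → List (Word m n)
  coversX u = map (λ i → insertX i u) (missing u)
  coversY []              = []
  coversY (x i ∷ w)       = map (x i ∷_) (coversY w)
  coversY (y j ∷ [])      = [] ∷ []
  coversY (y j ∷ x i ∷ w) = map (y j ∷_) (coversY (x i ∷ w))
  coversY (y j ∷ y l ∷ w) = (y l ∷ w) ∷ map (y j ∷_) (coversY (y l ∷ w))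
  coversT []              = []
  coversT (x i ∷ w)       = map (x i ∷_) (coversT w)
  coversT (y j ∷ [])      = []
  coversT (y j ∷ x i ∷ w) = (x i ∷ y j ∷ w) ∷ map (y j ∷_) (coversT (x i ∷ w))
  coversT (y j ∷ y l ∷ w) = map (y j ∷_) (coversT (y l ∷ w))

  -- `CoverX` alone would admit an x i that is already present or stands out of order, so the set is
  -- cut down by `Sorted u'`.
  card-coversX : Sorted u → HasCard (λ u' → Sorted u' × ∃ λ i → CoverX i u' u) (length (missing u))
  card-coversX {u} su = coversX u , unique , (λ u' → mk⇔ to from) , length-map _ (missing u)
    where
    absent? : ∀ i → Dec (x i ∉ u)
    absent? i = ¬? (x i ∈? u)
    absent : ∀ {i} → i ∈ missing u → x i ∉ u
    absent p = proj₂ (∈-filter⁻ absent? {xs = allFin m} p)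
    insertX-remove : ∀ i → Remove (x i) (insertX i u) u
    insertX-remove i = coverX⇒remove (insertX-coverX i u)
    map-unique : ∀ {L} → All (λ i → x i ∉ u) L → Unique L → Unique (map (λ i → insertX i u) L)
    map-unique []       []      = []
    map-unique {i ∷ L} (h ∷ hs) uL@(_ ∷ t) = All.tabulate distinct ∷ map-unique hs t
      where
      distinct : ∀ {v} → v ∈ map (λ i → insertX i u) L → insertX i u ≢ v
      distinct p refl with k , k∈L , e ← ∈-map⁻ _ p
        with remove-⊆ (insertX-remove k) (subst (x i ∈_) e (remove-∈ (insertX-remove i)))
      ... | inj₁ refl = Unique[x∷xs]⇒x∉xs uL k∈L
      ... | inj₂ q    = h q
    unique : Unique (coversX u)
    unique = map-unique (All.tabulate absent) (filter⁺ absent? (allFin⁺ m))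
    to : ∀ {u'} → u' ∈ coversX u → Sorted u' × ∃ λ i → CoverX i u' u
    to p with i , q , refl ← ∈-map⁻ _ p = insertX-sorted su (absent q) , i , insertX-coverX i u
    from : ∀ {u'} → (Sorted u' × ∃ λ i → CoverX i u' u) → u' ∈ coversX u
    from (su' , i , r) rewrite coverX⇒insertX su' r =
      ∈-map⁺ _ (∈-filter⁺ absent? (∈-allFin i) (remove-∉ (sorted⇒unique su') (coverX⇒remove r)))

  coversY-sound : ∀ u → u' ∈ coversY u → ∃ λ j → CoverY j u' u
  coversY-sound (x i ∷ u) p with v , q , refl ← ∈-map⁻ (x i ∷_) p with j , r ← coversY-sound u q = j , there r
  coversY-sound (y j ∷ []) (here refl) = j , end
  coversY-sound (y j ∷ x i ∷ u) p with v , q , refl ← ∈-map⁻ (y j ∷_) p with l , r ← coversY-sound (x i ∷ u) q = l , there r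
  coversY-sound (y j ∷ y l ∷ u) (here refl) = j , next
  coversY-sound (y j ∷ y l ∷ u) (there p) with v , q , refl ← ∈-map⁻ (y j ∷_) p with k , r ← coversY-sound (y l ∷ u) q = k , there r

  coversY-complete : CoverY j u' u → u' ∈ coversY u
  coversY-complete end  = here refl
  coversY-complete next = here refl
  coversY-complete (there {c = x i} r) = ∈-map⁺ (x i ∷_) (coversY-complete r)
  coversY-complete (there {w = x _ ∷ _} {c = y j} r) = ∈-map⁺ (y j ∷_) (coversY-complete r)
  coversY-complete (there {w = y _ ∷ _} {c = y j} r) = there (∈-map⁺ (y j ∷_) (coversY-complete r))

  coversY-unique : Unique u → Unique (coversY u)
  coversY-unique {[]} un = []
  coversY-unique {x i ∷ u} (_ ∷ un) = map⁺ ∷-injectiveʳ (coversY-unique un)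
  coversY-unique {y j ∷ []} un = [] ∷ []
  coversY-unique {y j ∷ x i ∷ u} (_ ∷ un) = map⁺ ∷-injectiveʳ (coversY-unique un)
  coversY-unique {y j ∷ y l ∷ u} ((j≢l ∷ _) ∷ un) = All.tabulate distinct ∷ map⁺ ∷-injectiveʳ (coversY-unique un)
    where
    distinct : ∀ {v} → v ∈ map (y j ∷_) (coversY (y l ∷ u)) → y l ∷ u ≢ v
    distinct p refl with v , _ , e ← ∈-map⁻ (y j ∷_) p = j≢l (sym (∷-injectiveˡ e))

  coversT-sound : ∀ u → u' ∈ coversT u → ∃₂ λ i j → Swap (x i) (y j) u' u
  coversT-sound (x i ∷ u) p with v , q , refl ← ∈-map⁻ (x i ∷_) p with k , j , r ← coversT-sound u q = k , j , there r
  coversT-sound (y j ∷ x i ∷ u) (here refl) = i , j , here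
  coversT-sound (y j ∷ x i ∷ u) (there p) with v , q , refl ← ∈-map⁻ (y j ∷_) p with k , l , r ← coversT-sound (x i ∷ u) q = k , l , there r
  coversT-sound (y j ∷ y l ∷ u) p with v , q , refl ← ∈-map⁻ (y j ∷_) p with k , l , r ← coversT-sound (y l ∷ u) q = k , l , there r

  coversT-complete : Swap (x i) (y j) u' u → u' ∈ coversT u
  coversT-complete here = here refl
  coversT-complete (there {d = x i} r) = ∈-map⁺ (x i ∷_) (coversT-complete r)
  coversT-complete (there {w = x _ ∷ _} {d = y j} r) = there (∈-map⁺ (y j ∷_) (coversT-complete r))
  coversT-complete (there {w = y _ ∷ _} {d = y j} r) = ∈-map⁺ (y j ∷_) (coversT-complete r)

  coversT-unique : ∀ u → Unique (coversT u)
  coversT-unique [] = []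
  coversT-unique (x i ∷ u) = map⁺ ∷-injectiveʳ (coversT-unique u)
  coversT-unique (y j ∷ []) = []
  coversT-unique (y j ∷ x i ∷ u) = All.tabulate distinct ∷ map⁺ ∷-injectiveʳ (coversT-unique (x i ∷ u))
    where
    distinct : ∀ {v} → v ∈ map (y j ∷_) (coversT (x i ∷ u)) → x i ∷ y j ∷ u ≢ v
    distinct p refl with v , _ , e ← ∈-map⁻ (y j ∷_) p with () ← ∷-injectiveˡ e
  coversT-unique (y j ∷ y l ∷ u) = map⁺ ∷-injectiveʳ (coversT-unique (y l ∷ u))

  length-coversY-coversT : ∀ u → length (coversY u) + length (coversT u) ≡ countY u
  length-coversY-coversT [] = refl
  length-coversY-coversT (x i ∷ u) = ≡-trans
    (cong₂ _+_ (length-map (x i ∷_) (coversY u)) (length-map (x i ∷_) (coversT u)))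
    (length-coversY-coversT u)
  length-coversY-coversT (y j ∷ []) = refl
  length-coversY-coversT (y j ∷ x i ∷ u) = ≡-trans
    (cong₂ _+_ (length-map (y j ∷_) (coversY (x i ∷ u))) (cong suc (length-map (y j ∷_) (coversT (x i ∷ u)))))
    (≡-trans (+-suc (length (coversY (x i ∷ u))) _) (cong suc (length-coversY-coversT (x i ∷ u))))
  length-coversY-coversT (y j ∷ y l ∷ u) = cong suc (≡-trans
    (cong₂ _+_ (length-map (y j ∷_) (coversY (y l ∷ u))) (length-map (y j ∷_) (coversT (y l ∷ u))))
    (length-coversY-coversT (y l ∷ u)))

  indel transposition : Word m n → ℕ
  indel u         = length (missing u) + length (coversY u)
  transposition u = length (coversT u)

  inDegIndel : Sorted u → InDegIndel u (indel u)
  inDegIndel {u} su = card-⇔ to from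
    (card-⊎ disjoint (card-coversX su)
      (coversY u , coversY-unique (sorted⇒unique su) , (λ _ → mk⇔ (coversY-sound u) (coversY-complete ∘ proj₂)) , refl))
    where
    disjoint : ∀ {u'} → (Sorted u' × ∃ λ i → CoverX i u' u) → ¬ (∃ λ j → CoverY j u' u)
    disjoint (su' , i , r) (j , t) = remove-∉ (sorted⇒unique su') (coverX⇒remove r)
      (remove-⊇ (coverY⇒remove t) (remove-∈ (coverX⇒remove r)))
    to : ∀ {u'} → (Sorted u' × ∃ λ i → CoverX i u' u) ⊎ (∃ λ j → CoverY j u' u) → u' ⋖ u × ¬ SameLetters u' u
    to (inj₁ (su' , i , r)) = cover⇒⋖ su' su (coverX r)
      , λ same → remove-∉ (sorted⇒unique su') (coverX⇒remove r) (Equivalence.to (same (x i)) (remove-∈ (coverX⇒remove r)))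
    to (inj₂ (j , r)) = cover⇒⋖ (remove-allPairs (coverY⇒remove r) su) su (coverY r)
      , λ same → remove-∉ (sorted⇒unique su) (coverY⇒remove r) (Equivalence.from (same (y j)) (remove-∈ (coverY⇒remove r)))
    from : ∀ {u'} → u' ⋖ u × ¬ SameLetters u' u → (Sorted u' × ∃ λ i → CoverX i u' u) ⊎ (∃ λ j → CoverY j u' u)
    from (c , different) with ⋖⇒cover su c
    ... | coverX r = inj₁ (shuffle⇒sorted (proj₁ c) , _ , r)
    ... | coverY r = inj₂ (_ , r)
    ... | coverT r = contradiction (λ a → mk⇔ (swap-∈ r) (swap-∈ (swap-sym r))) different

  inDeg : Sorted u → InDeg u (indel u + transposition u)
  inDeg {u} su = card-⇔ to from
    (card-⊎ disjoint (inDegIndel su)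
      (coversT u , coversT-unique u , (λ _ → mk⇔ (coversT-sound u) λ { (_ , _ , r) → coversT-complete r }) , refl))
    where
    disjoint : ∀ {u'} → u' ⋖ u × ¬ SameLetters u' u → ¬ (∃₂ λ i j → Swap (x i) (y j) u' u)
    disjoint (_ , different) (i , j , r) = different λ a → mk⇔ (swap-∈ r) (swap-∈ (swap-sym r))
    to : ∀ {u'} → (u' ⋖ u × ¬ SameLetters u' u) ⊎ (∃₂ λ i j → Swap (x i) (y j) u' u) → u' ⋖ u
    to (inj₁ (c , _))     = c
    to (inj₂ (i , j , r)) = cover⇒⋖ (swap-allPairs xy (swap-sym r) su) su (coverT r)
    from : ∀ {u'} → u' ⋖ u → (u' ⋖ u × ¬ SameLetters u' u) ⊎ (∃₂ λ i j → Swap (x i) (y j) u' u)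
    from c with ⋖⇒cover su c
    ... | coverT r = inj₂ (_ , _ , r)
    ... | coverX r = inj₁ (c , λ same →
      remove-∉ (sorted⇒unique (shuffle⇒sorted (proj₁ c))) (coverX⇒remove r) (Equivalence.to (same _) (remove-∈ (coverX⇒remove r))))
    ... | coverY r = inj₁ (c , λ same →
      remove-∉ (sorted⇒unique su) (coverY⇒remove r) (Equivalence.from (same _) (remove-∈ (coverY⇒remove r))))

  private variable
    xs : List (Fin m)
    ys : List (Fin n)

  -- Enumeration of shuffle words

  mutual
    -- Words over the letters xs and ys; the two numbers are the exponents of q and t
    -- in the weight. The letters of xs are treated in turn: a letter is either outside
    -- every factor yx, and then present (weight 1) or absent (weight qt), or it is the
    -- x of the first factor yx. In the last case Pending chooses the y from ys.
    data Words : List (Fin m) → List (Fin n) → ℕ → ℕ → Word m n → Set where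
      nil   : Words [] [] 0 0 []
      skipY : Words [] ys p q w → Words [] (j ∷ ys) p q w
      consY : Words [] ys p q w → Words [] (j ∷ ys) (suc p) (suc q) (y j ∷ w)
      skipX : Words xs ys p q w → Words (i ∷ xs) ys (suc p) (suc q) w
      consX : Words xs ys p q w → Words (i ∷ xs) ys p q (x i ∷ w)
      pend  : Pending i xs ys p q w → Words (i ∷ xs) ys (suc p) q w

    data Pending (i : Fin m) (xs : List (Fin m)) : List (Fin n) → ℕ → ℕ → Word m n → Set where
      skipY : Pending i xs ys p q w → Pending i xs (j ∷ ys) p q w
      consY : Pending i xs ys p q w → Pending i xs (j ∷ ys) (suc p) (suc q) (y j ∷ w)
      close : Words xs ys p q w → Pending i xs (j ∷ ys) p q (y j ∷ x i ∷ w)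

  mutual
    words-xs : Words xs ys p q w → x i ∈ w → i ∈ xs
    words-xs (skipY r) t           = words-xs r t
    words-xs (consY r) (there t)   = words-xs r t
    words-xs (skipX r) t           = there (words-xs r t)
    words-xs (consX r) (here refl) = here refl
    words-xs (consX r) (there t)   = there (words-xs r t)
    words-xs (pend r)  t           = pending-xs r t

    pending-xs : Pending k xs ys p q w → x i ∈ w → i ∈ k ∷ xs
    pending-xs (skipY r) t                   = pending-xs r t
    pending-xs (consY r) (there t)           = pending-xs r t
    pending-xs (close r) (there (here refl)) = here refl
    pending-xs (close r) (there (there t))   = there (words-xs r t)

  mutual
    words-ys : Words xs ys p q w → y j ∈ w → j ∈ ys
    words-ys (skipY r) t           = there (words-ys r t)
    words-ys (consY r) (here refl) = here refl
    words-ys (consY r) (there t)   = there (words-ys r t)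
    words-ys (skipX r) t           = words-ys r t
    words-ys (consX r) (there t)   = words-ys r t
    words-ys (pend r)  t           = pending-ys r t

    pending-ys : Pending i xs ys p q w → y j ∈ w → j ∈ ys
    pending-ys (skipY r) t                 = there (pending-ys r t)
    pending-ys (consY r) (here refl)       = here refl
    pending-ys (consY r) (there t)         = there (pending-ys r t)
    pending-ys (close r) (here refl)       = here refl
    pending-ys (close r) (there (there t)) = there (words-ys r t)

  pending-∋ : Pending i xs ys p q w → x i ∈ w
  pending-∋ (skipY r) = pending-∋ r
  pending-∋ (consY r) = there (pending-∋ r)
  pending-∋ (close r) = there (here refl)

  -- A pending word begins with a y-letter. This tells `pend` from `consX` and `consY` from `close`,
  -- and it shows that a y-letter written by `consY` forms no factor.
  pending-head : Pending i xs ys p q w → w ≢ x k ∷ v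
  pending-head (skipY r) e = pending-head r e

  x-head : Increasing (i ∷ xs) → (∀ {k} → x k ∈ w → k ∈ xs) → All (x i ≺_) w
  x-head {i} {xs} {w} (h ∷ _) f = All.tabulate all
    where
    all : ∀ {c} → c ∈ w → x i ≺ c
    all {x k} t = xx (All.lookup h (f t))
    all {y j} t = xy

  y-head : Increasing (j ∷ ys) → (∀ {l} → y l ∈ w → l ∈ ys) → All (y j ≺_) w
  y-head {j} {ys} {w} (h ∷ _) f = All.tabulate all
    where
    all : ∀ {c} → c ∈ w → y j ≺ c
    all {x k} t = yx
    all {y l} t = yy (All.lookup h (f t))

  mutual
    words-sorted : Increasing xs → Increasing ys → Words xs ys p q w → Sorted w
    words-sorted ix iy         nil       = []
    words-sorted ix (_ ∷ iy)   (skipY r) = words-sorted ix iy r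
    words-sorted ix iy@(_ ∷ t) (consY r) = y-head iy (words-ys r) ∷ words-sorted ix t r
    words-sorted (_ ∷ ix) iy   (skipX r) = words-sorted ix iy r
    words-sorted ix@(_ ∷ t) iy (consX r) = x-head ix (words-xs r) ∷ words-sorted t iy r
    words-sorted ix iy         (pend r)  = pending-sorted ix iy r

    pending-sorted : Increasing (i ∷ xs) → Increasing ys → Pending i xs ys p q w → Sorted w
    pending-sorted ix (_ ∷ iy)   (skipY r) = pending-sorted ix iy r
    pending-sorted ix iy@(_ ∷ t) (consY r) = y-head iy (pending-ys r) ∷ pending-sorted ix t r
    pending-sorted ix@(_ ∷ s) iy@(_ ∷ t) (close r) =
      (yx ∷ y-head iy (words-ys r)) ∷ x-head ix (words-xs r) ∷ words-sorted s t r

  transposition-y : ∀ j w → (∀ {k v} → w ≢ x k ∷ v) → transposition (y j ∷ w) ≡ transposition w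
  transposition-y j []        h = refl
  transposition-y j (x k ∷ w) h = contradiction refl h
  transposition-y j (y l ∷ w) h = length-map (y j ∷_) (coversT (y l ∷ w))

  transposition-x : ∀ i w → transposition (x i ∷ w) ≡ transposition w
  transposition-x i w = length-map (x i ∷_) (coversT w)

  transposition-yx : ∀ j i w → transposition (y j ∷ x i ∷ w) ≡ suc (transposition w)
  transposition-yx j i w =
    cong suc (≡-trans (length-map (y j ∷_) (coversT (x i ∷ w))) (transposition-x i w))

  mutual
    -- The exponents rise together except at `pend`, where p rises alone, and each `pend` leads to
    -- one factor yx, written by `close`. While x i is pending, that factor belongs to w but its q
    -- is not yet part of p, whence `suc p` in `pending-q`.
    words-q : Words xs ys p q w → q + transposition w ≡ p
    words-q nil       = refl
    words-q (skipY r) = words-q r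
    words-q (consY {q = q} {w = w} {j = j} r) = cong suc (≡-trans
      (cong (q +_) (transposition-y j w λ { refl → contradiction (words-xs r (here refl)) λ () }))
      (words-q r))
    words-q (skipX r) = cong suc (words-q r)
    words-q (consX {q = q} {w = w} {i = i} r) = ≡-trans (cong (q +_) (transposition-x i w)) (words-q r)
    words-q (pend r)  = pending-q r

    pending-q : Pending i xs ys p q w → q + transposition w ≡ suc p
    pending-q (skipY r) = pending-q r
    pending-q (consY {q = q} {w = w} {j = j} r) =
      cong suc (≡-trans (cong (q +_) (transposition-y j w (pending-head r))) (pending-q r))
    pending-q {i = i} (close {q = q} {w = w} {j = j} r) =
      ≡-trans (cong (q +_) (transposition-yx j i w)) (≡-trans (+-suc q _) (cong suc (words-q r)))

  mutual
    -- Charging the q of each factor to its y-letter makes p the number of absent x-letters plus the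
    -- number of present y-letters. The additive form avoids truncated subtraction.
    words-p : Words xs ys p q w → p + length (xsOf w) ≡ length xs + countY w
    words-p nil       = refl
    words-p (skipY r) = words-p r
    words-p (consY r) = cong suc (words-p r)
    words-p (skipX r) = cong suc (words-p r)
    words-p (consX {p = p} r) = ≡-trans (+-suc p _) (cong suc (words-p r))
    words-p (pend r)  = cong suc (pending-p r)

    pending-p : Pending i xs ys p q w → p + length (xsOf w) ≡ length xs + countY w
    pending-p (skipY r) = pending-p r
    pending-p {xs = xs} (consY r) = ≡-trans (cong suc (pending-p r)) (sym (+-suc (length xs) _))
    pending-p {xs = xs} (close {p = p} r) =
      ≡-trans (+-suc p _) (≡-trans (cong suc (words-p r)) (sym (+-suc (length xs) _)))

  -- Completeness of the enumeration

  tail-xs : Sorted (x i ∷ w) → (∀ {k} → x k ∈ x i ∷ w → k ∈ i ∷ xs) → ∀ {k} → x k ∈ w → k ∈ xs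
  tail-xs s f t with f (there t)
  ... | here refl = contradiction t (Unique[x∷xs]⇒x∉xs (sorted⇒unique s))
  ... | there r   = r

  tail-ys : Sorted (y j ∷ w) → (∀ {l} → y l ∈ y j ∷ w → l ∈ j ∷ ys) → ∀ {l} → y l ∈ w → l ∈ ys
  tail-ys s f t with f (there t)
  ... | here refl = contradiction t (Unique[x∷xs]⇒x∉xs (sorted⇒unique s))
  ... | there r   = r

  smallest-x : Increasing (i ∷ xs) → Sorted (x k ∷ w) → x i ∈ x k ∷ w → k ∈ i ∷ xs → k ≡ i
  smallest-x ix       s       t           (here e)  = e
  smallest-x ix       s       (here refl) (there r) = refl
  smallest-x (h ∷ _)  (g ∷ _) (there t)   (there r) with All.lookup g t
  ... | xx k<i = contradiction (All.lookup h r) (ℕ.<-asym k<i)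

  smallest-y : Increasing (j ∷ ys) → Sorted (y l ∷ w) → y j ∈ y l ∷ w → l ∈ j ∷ ys → l ≡ j
  smallest-y iy       s       t           (here e)  = e
  smallest-y iy       s       (here refl) (there r) = refl
  smallest-y (h ∷ _)  (g ∷ _) (there t)   (there r) with All.lookup g t
  ... | yy l<j = contradiction (All.lookup h r) (ℕ.<-asym l<j)

  skip-ys : y j ∉ w → (∀ {l} → y l ∈ w → l ∈ j ∷ ys) → ∀ {l} → y l ∈ w → l ∈ ys
  skip-ys j∉w f t with f t
  ... | here refl = contradiction t j∉w
  ... | there r   = r

  skip-xs : x i ∉ w → (∀ {k} → x k ∈ w → k ∈ i ∷ xs) → ∀ {k} → x k ∈ w → k ∈ xs
  skip-xs i∉w f t with f t
  ... | here refl = contradiction t i∉w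
  ... | there r   = r

  mutual
    -- The smallest available x i, if it occurs, is the first x-letter of w. So when w begins with a
    -- y-letter, only y-letters precede x i, and the last of them forms the first factor with it.
    words-complete : ∀ xs ys w → Increasing xs → Increasing ys → Sorted w →
                     (∀ {i} → x i ∈ w → i ∈ xs) → (∀ {j} → y j ∈ w → j ∈ ys) → ∃₂ λ p q → Words xs ys p q w
    words-complete [] [] [] ix iy s f g = _ , _ , nil
    words-complete [] [] (x i ∷ w) ix iy s f g with () ← f (here refl)
    words-complete [] [] (y j ∷ w) ix iy s f g with () ← g (here refl)
    words-complete [] (j ∷ ys) w ix iy s f g with y j ∈? w
    ... | no j∉w with _ , _ , r ← words-complete [] ys w ix (AllPairs.tail iy) s f (skip-ys j∉w g) = _ , _ , skipY r
    words-complete [] (j ∷ ys) (x i ∷ w) ix iy s f g | yes _ with () ← f (here refl)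
    words-complete [] (j ∷ ys) (y l ∷ w) ix iy s f g | yes j∈w with refl ← smallest-y iy s j∈w (g (here refl))
      with _ , _ , r ← words-complete [] ys w ix (AllPairs.tail iy) (AllPairs.tail s) (f ∘ there) (tail-ys s g) = _ , _ , consY r
    words-complete (i ∷ xs) ys w ix iy s f g with x i ∈? w
    ... | no i∉w with _ , _ , r ← words-complete xs ys w (AllPairs.tail ix) iy s (skip-xs i∉w f) g = _ , _ , skipX r
    words-complete (i ∷ xs) ys (x k ∷ w) ix iy s f g | yes i∈w with refl ← smallest-x ix s i∈w (f (here refl))
      with _ , _ , r ← words-complete xs ys w (AllPairs.tail ix) iy (AllPairs.tail s) (tail-xs s f) (g ∘ there) = _ , _ , consX r
    words-complete (i ∷ xs) ys (y l ∷ w) ix iy s f g | yes i∈w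
      with _ , _ , r ← pending-complete i xs ys l w ix iy s f g i∈w = _ , _ , pend r

    pending-complete : ∀ i xs ys l w → Increasing (i ∷ xs) → Increasing ys → Sorted (y l ∷ w) →
                       (∀ {k} → x k ∈ y l ∷ w → k ∈ i ∷ xs) → (∀ {j} → y j ∈ y l ∷ w → j ∈ ys) →
                       x i ∈ y l ∷ w → ∃₂ λ p q → Pending i xs ys p q (y l ∷ w)
    pending-complete i xs [] l w ix iy s f g i∈w with () ← g (here refl)
    pending-complete i xs (j ∷ ys) l w ix iy s f g i∈w with y j ∈? (y l ∷ w)
    ... | no j∉w with _ , _ , r ← pending-complete i xs ys l w ix (AllPairs.tail iy) s f (skip-ys j∉w g) i∈w = _ , _ , skipY r
    ... | yes j∈w with refl ← smallest-y iy s j∈w (g (here refl)) = start w s f g i∈w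
      where
      start : ∀ w → Sorted (y j ∷ w) → (∀ {k} → x k ∈ y j ∷ w → k ∈ i ∷ xs) →
              (∀ {l} → y l ∈ y j ∷ w → l ∈ j ∷ ys) → x i ∈ y j ∷ w →
              ∃₂ λ p q → Pending i xs (j ∷ ys) p q (y j ∷ w)
      start [] s f g (there ())
      -- The first x-letter after the run of y-letters must be x i, so the y-letter just read closes
      -- the factor.
      start (x k ∷ w) s f g (there i∈w) with refl ← smallest-x ix (AllPairs.tail s) i∈w (f (there (here refl)))
        with _ , _ , r ← words-complete xs ys w (AllPairs.tail ix) (AllPairs.tail iy) (AllPairs.tail (AllPairs.tail s))
                           (tail-xs (AllPairs.tail s) (f ∘ there)) (tail-ys s g ∘ there) = _ , _ , close r
      start (y k ∷ w) s f g (there i∈w)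
        with _ , _ , r ← pending-complete i xs ys k w ix (AllPairs.tail iy) (AllPairs.tail s) (f ∘ there) (tail-ys s g) i∈w =
          _ , _ , consY r

  -- Counting the enumerated words

  private variable
    F : ℕ → ℕ → Word m n → Set
    f : ℕ → ℕ → ℕ

  data RaiseQ (F : ℕ → ℕ → Word m n → Set) : ℕ → ℕ → Word m n → Set where
    raiseQ : F p q w → RaiseQ F (suc p) q w

  data RaiseT (F : ℕ → ℕ → Word m n → Set) : ℕ → ℕ → Word m n → Set where
    raiseT : F p q w → RaiseT F p (suc q) w

  card-mulQ : (∀ p q → HasCard (F p q) (f p q)) → ∀ p q → HasCard (RaiseQ F p q) (mulQ f p q)
  card-mulQ h zero    q = card-∅ λ ()
  card-mulQ h (suc p) q = card-⇔ raiseQ (λ { (raiseQ r) → r }) (h p q)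

  card-mulT : (∀ p q → HasCard (F p q) (f p q)) → ∀ p q → HasCard (RaiseT F p q) (mulT f p q)
  card-mulT h p zero    = card-∅ λ ()
  card-mulT h p (suc q) = card-⇔ raiseT (λ { (raiseT r) → r }) (h p q)

  card-mulQT : (∀ p q → HasCard (F p q) (f p q)) → ∀ p q → HasCard (RaiseQ (RaiseT F) p q) (mulQT f p q)
  card-mulQT h = card-mulQ (card-mulT h)

  card-nil : ∀ p q → HasCard (Words [] [] p q) (oneP p q)
  card-nil zero    zero    = ([] ∷ []) , [] ∷ [] , (λ w → mk⇔ (λ { (here refl) → nil }) (λ { nil → here refl })) , refl
  card-nil zero    (suc q) = card-∅ λ ()
  card-nil (suc p) q       = card-∅ λ ()

  mutual
    -- Each constructor matches one summand of the recurrences for `sumA` and `sumB`. Words are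
    -- counted, not derivations, so the constructors must yield disjoint sets; these are told apart
    -- by the presence of the letter in question and by the beginning of the word.
    card-words : ∀ N xs ys → Increasing xs → Increasing ys → length xs ≤ N →
                 ∀ p q → HasCard (Words xs ys p q) (sumA N (length xs) (length ys) p q)
    card-words N [] [] ix iy h p q = subst (HasCard _) (sym (sumA-zeroˡ N 0 p q)) (card-nil p q)
    card-words N [] (j ∷ ys) ix iy h p q = subst (HasCard _) (sym (sumA-zeroˡ-sucʳ N (length ys) p q)) (card-⇔ to from
      (card-⊎ disjoint (rec p q) (card-image (y j ∷_) ∷-injectiveʳ (card-mulQT rec p q))))
      where
      rec : ∀ p q → HasCard (Words [] ys p q) (sumA N 0 (length ys) p q)
      rec = card-words N [] ys ix (AllPairs.tail iy) h
      disjoint : ∀ {w} → Words [] ys p q w → ¬ Image (y j ∷_) (RaiseQ (RaiseT (Words [] ys)) p q) w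
      disjoint r (_ , refl , _) = increasing⇒∉ iy (words-ys r (here refl))
      to : ∀ {w} → Words [] ys p q w ⊎ Image (y j ∷_) (RaiseQ (RaiseT (Words [] ys)) p q) w → Words [] (j ∷ ys) p q w
      to (inj₁ r)                             = skipY r
      to (inj₂ (_ , refl , raiseQ (raiseT r))) = consY r
      from : ∀ {w} → Words [] (j ∷ ys) p q w → Words [] ys p q w ⊎ Image (y j ∷_) (RaiseQ (RaiseT (Words [] ys)) p q) w
      from (skipY r) = inj₁ r
      from (consY r) = inj₂ (_ , refl , raiseQ (raiseT r))
    card-words (suc N) (i ∷ xs) ys ix iy (s≤s h) p q =
      subst (HasCard _) (sym (sumA-sucˡ N (length xs) (length ys) p q)) (card-⇔ to from
      (card-⊎ disjoint
        (card-⊎ disjoint' (card-image (x i ∷_) ∷-injectiveʳ (rec p q)) (card-mulQT rec p q))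
        -- The bound drops here alone, because opening a factor uses up one unit of the index a.
        (card-mulQ (card-pending N i xs ys ix iy h) p q)))
      where
      rec : ∀ p q → HasCard (Words xs ys p q) (sumA (suc N) (length xs) (length ys) p q)
      rec = card-words (suc N) xs ys (AllPairs.tail ix) iy (ℕ.m≤n⇒m≤1+n h)
      Outside : Word m n → Set
      Outside w = Image (x i ∷_) (Words xs ys p q) w ⊎ RaiseQ (RaiseT (Words xs ys)) p q w
      disjoint' : ∀ {w} → Image (x i ∷_) (Words xs ys p q) w → ¬ RaiseQ (RaiseT (Words xs ys)) p q w
      disjoint' (_ , refl , _) (raiseQ (raiseT r)) = increasing⇒∉ ix (words-xs r (here refl))
      disjoint : ∀ {w} → Outside w → ¬ RaiseQ (Pending i xs ys) p q w
      disjoint (inj₁ (_ , refl , _))      (raiseQ r) = pending-head r refl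
      disjoint (inj₂ (raiseQ (raiseT t))) (raiseQ r) = increasing⇒∉ ix (words-xs t (pending-∋ r))
      to : ∀ {w} → Outside w ⊎ RaiseQ (Pending i xs ys) p q w → Words (i ∷ xs) ys p q w
      to (inj₁ (inj₁ (_ , refl , r)))      = consX r
      to (inj₁ (inj₂ (raiseQ (raiseT r)))) = skipX r
      to (inj₂ (raiseQ r))                 = pend r
      from : ∀ {w} → Words (i ∷ xs) ys p q w → Outside w ⊎ RaiseQ (Pending i xs ys) p q w
      from (consX r) = inj₁ (inj₁ (_ , refl , r))
      from (skipX r) = inj₁ (inj₂ (raiseQ (raiseT r)))
      from (pend r)  = inj₂ (raiseQ r)

    card-pending : ∀ N i xs ys → Increasing (i ∷ xs) → Increasing ys → length xs ≤ N →
                   ∀ p q → HasCard (Pending i xs ys p q) (sumB N (length xs) (length ys) p q)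
    card-pending N i xs [] ix iy h p q = subst (HasCard _) (sym (sumB-zeroʳ N (length xs) p q)) (card-∅ λ ())
    card-pending N i xs (j ∷ ys) ix iy h p q =
      subst (HasCard _) (sym (sumB-sucʳ N (length xs) (length ys) p q)) (card-⇔ to from
      (card-⊎ disjoint
        (card-⊎ disjoint' (rec p q) (card-image (y j ∷_) ∷-injectiveʳ (card-mulQT rec p q)))
        (card-image (λ w → y j ∷ x i ∷ w) (∷-injectiveʳ ∘ ∷-injectiveʳ)
          (card-words N xs ys (AllPairs.tail ix) (AllPairs.tail iy) h p q))))
      where
      rec : ∀ p q → HasCard (Pending i xs ys p q) (sumB N (length xs) (length ys) p q)
      rec = card-pending N i xs ys ix (AllPairs.tail iy) h
      Outside Closed : Word m n → Set
      Outside w = Pending i xs ys p q w ⊎ Image (y j ∷_) (RaiseQ (RaiseT (Pending i xs ys)) p q) w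
      Closed    = Image (λ w → y j ∷ x i ∷ w) (Words xs ys p q)
      disjoint' : ∀ {w} → Pending i xs ys p q w → ¬ Image (y j ∷_) (RaiseQ (RaiseT (Pending i xs ys)) p q) w
      disjoint' r (_ , refl , _) = increasing⇒∉ iy (pending-ys r (here refl))
      disjoint : ∀ {w} → Outside w → ¬ Closed w
      disjoint (inj₁ r)                              (_ , refl , _) = increasing⇒∉ iy (pending-ys r (here refl))
      disjoint (inj₂ (_ , refl , raiseQ (raiseT r))) (_ , refl , _) = pending-head r refl
      to : ∀ {w} → Outside w ⊎ Closed w → Pending i xs (j ∷ ys) p q w
      to (inj₁ (inj₁ r))                              = skipY r
      to (inj₁ (inj₂ (_ , refl , raiseQ (raiseT r)))) = consY r
      to (inj₂ (_ , refl , r))                        = close r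
      from : ∀ {w} → Pending i xs (j ∷ ys) p q w → Outside w ⊎ Closed w
      from (skipY r) = inj₁ (inj₁ r)
      from (consY r) = inj₁ (inj₂ (_ , refl , raiseQ (raiseT r)))
      from (close r) = inj₂ (_ , refl , r)

  -- Both totals equal the number of absent x-letters plus the number of present y-letters. Adding X
  -- to both sides makes the additive count of the absent letters applicable; subtracting the
  -- transpositions yields q.
  words-degrees : Sorted w → length xs ≡ m → Words xs ys p q w → indel w + transposition w ≡ p × indel w ≡ q
  words-degrees {w} {xs} {p = p} {q = q} s e r = total , +-cancelʳ-≡ (transposition w) (indel w) q (≡-trans total (sym (words-q r)))
    where
    open ≡-Reasoning
    M X : ℕ
    M = length (missing w)
    X = length (xsOf w)
    total : indel w + transposition w ≡ p
    total = +-cancelʳ-≡ X _ p (begin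
      M + length (coversY w) + transposition w + X    ≡⟨ cong (_+ X) (+-assoc M _ _) ⟩
      M + (length (coversY w) + transposition w) + X  ≡⟨ cong (λ c → M + c + X) (length-coversY-coversT w) ⟩
      M + countY w + X                                ≡⟨ +-assoc M _ X ⟩
      M + (countY w + X)                              ≡⟨ cong (M +_) (+-comm (countY w) X) ⟩
      M + (X + countY w)                              ≡⟨ +-assoc M X _ ⟨
      M + X + countY w                                ≡⟨ cong (_+ countY w) (length-missing (sorted⇒unique s)) ⟩
      m + countY w                                    ≡⟨ cong (_+ countY w) e ⟨
      length xs + countY w                            ≡⟨ words-p r ⟨
      p + X                                           ∎)

theorem1p3 : ∀ (m n : ℕ) → ∀ (i j : ℕ) → HCoeff m n i j (RHS m n i j)
theorem1p3 m n i j = subst (HasCard _) count (card-⇔ to from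
  (card-words m (allFin m) (allFin n) (increasing m) (increasing n) (ℕ.≤-reflexive (length-tabulate id)) i j))
  where
  increasing : ∀ k → Increasing (allFin k)
  increasing k = AllPairs.tabulate⁺-< id
  count : sumA m (length (allFin m)) (length (allFin n)) i j ≡ RHS m n i j
  count = ≡-trans (cong₂ (λ k l → sumA m k l i j) (length-tabulate {n = m} id) (length-tabulate {n = n} id)) (sumA-RHS m n i j)
  to : ∀ {u} → Words (allFin m) (allFin n) i j u → IsShuffle u × InDeg u i × InDegIndel u j
  to r with s ← words-sorted (increasing m) (increasing n) r
    with refl , refl ← words-degrees s (length-tabulate id) r = sorted⇒shuffle s , inDeg s , inDegIndel s
  from : ∀ {u} → IsShuffle u × InDeg u i × InDegIndel u j → Words (allFin m) (allFin n) i j u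
  from {u} (sh , d , e) with s ← shuffle⇒sorted sh
    with p , q , r ← words-complete (allFin m) (allFin n) u (increasing m) (increasing n) s (λ _ → ∈-allFin _) (λ _ → ∈-allFin _)
    with refl , refl ← words-degrees s (length-tabulate id) r
    -- The exponents read off from u are its in-degrees, and a set has only one cardinality, so they
    -- are the given i and j.
    with refl ← card-unique d (inDeg s) | refl ← card-unique e (inDegIndel s) = r
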